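{- Let $n,k,r,s,a$ be integers with $k,r\ge2$, $n>a\ge0$, $n\ge rk$, $0\le s<k$ and $a\le r(k-s-1)$. Then $$\chi(\mathrm{KG}^r(n,k,a,s))\ge\left\lceil\frac{n-r(k-\lfloor s/2\rfloor-1)}{r-1}\right\rceil.$$
   Context: For $A,B\subseteq[n]$, write $A\subseteq_sB$ if there is a set $E$ with $|E|\le s$ and $A\setminus E\subseteq B$. $\mathcal{H}(n,k,a,s)$ is the family of all $k$-subsets $F\subseteq[n]$ with $F\not\subseteq_s\{n-a+1,\dots,n\}$. $\mathrm{KG}^r(n,k,a,s)$ is the $r$-uniform hypergraph with vertex set $\mathcal{H}(n,k,a,s)$ and edges all $r$-subsets $\{F_1,\dots,F_r\}$ of vertices with $|F_i\cap F_j|\le s$ for all $1\le i<j\le r$. $\chi$ is the chromatic number (minimum number of colors in a vertex coloring with no monochromatic edge). -}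

module Defs where

open import Data.Nat using (ℕ; zero; suc; _+_; _*_; _∸_; _≤_; _<_; _/_; ⌊_/2⌋)
open import Data.Nat.Properties using (_≤?_)
open import Data.Fin using (Fin; toℕ)
open import Data.Fin.Subset using (Subset; inside; outside; _⊆_; _─_; _∩_; ∣_∣)
open import Data.Vec using (tabulate)
open import Data.Product using (Σ; ∃; _×_; proj₁)
open import Relation.Nullary using (¬_; yes; no)
open import Relation.Binary.PropositionalEquality using (_≡_)
open import Function.Definitions using (Injective)

-- Ground set [n] = {1,…,n} is modelled by Fin n, index i standing for i+1.

_⊆[_]_ : {n : ℕ} → Subset n → ℕ → Subset n → Set
_⊆[_]_ {n} A s B = Σ (Subset n) λ E → (∣ E ∣ ≤ s) × ((A ─ E) ⊆ B)

-- {n-a+1, …, n} : the indices i with n - a ≤ i (0-based)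
lastSet : (n a : ℕ) → Subset n
lastSet n a = tabulate λ i → decide (n ∸ a ≤? toℕ i)
  where
  decide : ∀ {P : Set} → Relation.Nullary.Dec P → _
  decide (yes _) = inside
  decide (no _)  = outside

H : (n k a s : ℕ) → Set
H n k a s = Σ (Subset n) λ F → (∣ F ∣ ≡ k) × ¬ (F ⊆[ s ] lastSet n a)

record Edge (n k a s r : ℕ) : Set where
  field
    members  : Fin r → H n k a s
    distinct : Injective _≡_ _≡_ (λ i → proj₁ (members i))
    sparse   : ∀ i j → ¬ (i ≡ j) → ∣ proj₁ (members i) ∩ proj₁ (members j) ∣ ≤ s

ProperColouring : (n k a s r m : ℕ) → (H n k a s → Fin m) → Set
ProperColouring n k a s r m c =
  (e : Edge n k a s r) → ¬ (∀ i j → c (Edge.members e i) ≡ c (Edge.members e j))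

χ≥ : (n k a s r t : ℕ) → Set
χ≥ n k a s r t = ∀ m (c : H n k a s → Fin m) → ProperColouring n k a s r m c → t ≤ m

-- ceiling division ⌈x / d⌉ for d ≥ 1 (value at d = 0 is irrelevant, set to 0)
⌈_/'_⌉ : ℕ → ℕ → ℕ
⌈ x /' zero ⌉ = 0
⌈ x /' suc d ⌉ = (x + d) / suc d

{-# OPTIONS --safe #-}
module Submission where

-- Enlarging pairwise disjoint sets by ⌊ s /2⌋ elements each creates intersections of size at most s, so it
-- suffices to find r pairwise disjoint (q+1)-sets of one colour, each with more than t elements outside B,
-- whenever n > (r-1)m + rq and ∣ B ∣ ≤ r(q-t).  This statement is multiplicative in r, so r may be assumed to be a prime p.
--
-- For r = p, words w ∈ (ℤ/p ∪ {0})ⁿ describe families of p disjoint subsets w₀,…,w_{p-1} of [n]. Every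
-- ℤ/p-equivariant map from the nonzero words to ℤ/p takes distinct consecutive values along some maximal
-- chain of words (a form of the ℤ_p-Tucker lemma).  It is applied to a map which, without a monochromatic
-- edge, is constant along every step at which
--   Φ(w) = ∑ᵢ min(∣wᵢ∣, q) + ∑_c #{ i | wᵢ contains an admissible set of colour c } ≤ pq + (p-1)m
-- does not increase; so the chain gives n ≤ pq + (p-1)m.

open import Defs
open import Data.Bool using (Bool; true; false; not)
open import Data.Fin as Fin using (Fin; zero; suc; toℕ; fromℕ<; remQuot)
import Data.Fin.Properties as Fin
open import Data.Fin.Permutation using (permutation)
open import Data.Fin.Subset as Subset using (Subset; inside; outside; _∈_; _∉_; _⊆_; _∩_; _∪_; _─_; ∣_∣; ⊥; ⊤)
import Data.Fin.Subset.Properties as Subset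
open import Data.Integer as ℤ using (ℤ; 0ℤ; 1ℤ)
import Data.Integer.Properties as ℤ
open import Data.Integer.Tactic.RingSolver using (solve-∀)
open import Data.List using ([]; _∷_)
open import Data.List.Relation.Unary.All using (All; []; _∷_)
open import Data.Maybe using (Maybe; just; nothing)
open import Data.Nat as ℕ using (ℕ; zero; suc; NonZero)
import Data.Nat.Properties as ℕ
open import Data.Nat.Coprimality using (coprime-Bézout; prime⇒coprime)
open import Data.Nat.DivMod using (_%_; _mod_; m<n⇒m%n≡m; n%n≡0; m%n<n; %-distribˡ-+; m%n%n≡m%n; [m+n]%n≡m%n; m≡m%n+[m/n]*n; [m+kn]%n≡m%n; m/n*n≤m)
open import Data.Nat.GCD using (module Bézout)
open import Data.Nat.ListAction using (product)
open import Data.Nat.Primality using (Prime; prime⇒nonZero; prime⇒nonTrivial; productOfPrimes≢0)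
open import Data.Nat.Primality.Factorisation using (factorise; module PrimeFactorisation)
import Data.Nat.Tactic.RingSolver as ℕSolver
open import Data.Product using (Σ; ∃; _×_; _,_; proj₁; proj₂; uncurry)
open import Data.Sum using (_⊎_; inj₁; inj₂; [_,_]′)
open import Data.Vec using (Vec; []; _∷_; here; there)
open import Data.Vec.Properties using (lookup∘tabulate; []=⇒lookup)
open import Function using (_∘_; id; mk⇔)
open import Relation.Binary.PropositionalEquality
open import Relation.Nullary using (¬_; Dec; yes; no; does; contradiction; _×-dec_)
open import Relation.Nullary.Decidable using (does-⇔; dec-true)

-- Put u = ⌊ s /2⌋, t = ⌈ s /2⌉ and q = k - u - 1. A k-set with more than s = u + t elements outside
-- B keeps more than t of them after losing u elements; this is the origin of the threshold t, and q
-- - t = k - s - 1 turns the hypothesis on a into ∣ B ∣ ≤ r(q - t). The sign of a word must be an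
-- equivariant choice of a point of ℤ/p. The data at hand are subsets of ℤ/p: the indices i for
-- which wᵢ contains an admissible set of a given colour, has at least q elements, or has more than
-- t elements outside B. The empty and the full subset admit no equivariant choice; any other has a
-- barycentre once its size is invertible modulo p, whence the reduction to primes. The danger is a
-- stationary step at which all these subsets are trivial, so that a mere default decides; the bound
-- on ∣ B ∣ serves to exclude it. The Tucker lemma is cohomological: a top-dimensional cochain built
-- from the signs takes a value congruent to 1 modulo p on an explicit chain, and it vanishes at
-- every word that does not end an alternating chain.

module IntegerSums where

  open import Data.Integer using (+_; _+_; _-_; _*_)
  open ≡-Reasoning

  ∑< : ℕ → (ℕ → ℤ) → ℤ
  ∑< zero    f = 0ℤ
  ∑< (suc k) f = ∑< k f + f k

  ∑<-cong : ∀ k {f g : ℕ → ℤ} → (∀ j → f j ≡ g j) → ∑< k f ≡ ∑< k g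
  ∑<-cong zero    eq = refl
  ∑<-cong (suc k) eq = cong₂ _+_ (∑<-cong k eq) (eq k)

  ∑<-sub : ∀ k (f g : ℕ → ℤ) → ∑< k (λ j → f j - g j) ≡ ∑< k f - ∑< k g
  ∑<-sub zero    f g = refl
  ∑<-sub (suc k) f g = trans (cong (_+ (f k - g k)) (∑<-sub k f g)) (lem (∑< k f) (∑< k g) (f k) (g k))
    where
    lem : ∀ a b c d → a - b + (c - d) ≡ a + c - (b + d)
    lem = solve-∀

  ∑<-*ˡ : ∀ k x (f : ℕ → ℤ) → ∑< k (λ j → x * f j) ≡ x * ∑< k f
  ∑<-*ˡ zero    x f = sym (ℤ.*-zeroʳ x)
  ∑<-*ˡ (suc k) x f = trans (cong (_+ x * f k) (∑<-*ˡ k x f)) (sym (ℤ.*-distribˡ-+ x (∑< k f) (f k)))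

  ∑<-const : ∀ k x → ∑< k (λ _ → x) ≡ + k * x
  ∑<-const zero    x = sym (ℤ.*-zeroˡ x)
  ∑<-const (suc k) x = trans (cong (_+ x) (∑<-const k x)) (sym (trans (cong (_* x) (ℤ.+-comm (+ 1) (+ k))) (lem (+ k) x)))
    where
    lem : ∀ k x → (k + + 1) * x ≡ k * x + x
    lem = solve-∀

  ∑<-shift : ∀ k (f : ℕ → ℤ) → ∑< k (f ∘ suc) + f 0 ≡ ∑< k f + f k
  ∑<-shift zero    f = refl
  ∑<-shift (suc k) f = trans (lem (∑< k (f ∘ suc)) (f (suc k)) (f 0)) (cong (_+ f (suc k)) (∑<-shift k f))
    where
    lem : ∀ a b c → a + b + c ≡ a + c + b
    lem = solve-∀

  ∑<-cyclic : ∀ k (f : ℕ → ℤ) → f k ≡ f 0 → ∑< k (f ∘ suc) ≡ ∑< k f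
  ∑<-cyclic k f eq = begin
    ∑< k (f ∘ suc)                 ≡⟨ lem (∑< k (f ∘ suc)) (f 0) ⟩
    ∑< k (f ∘ suc) + f 0 - f 0     ≡⟨ cong (_- f 0) (trans (∑<-shift k f) (cong (λ x → ∑< k f + x) eq)) ⟩
    ∑< k f + f 0 - f 0             ≡⟨ sym (lem (∑< k f) (f 0)) ⟩
    ∑< k f                         ∎
    where
    lem : ∀ a b → a ≡ a + b - b
    lem = solve-∀

  ∑<-nonzero : ∀ k (f : ℕ → ℤ) → ∑< k f ≢ 0ℤ → ∃ λ j → f j ≢ 0ℤ
  ∑<-nonzero zero    f ne = contradiction refl ne
  ∑<-nonzero (suc k) f ne with f k ℤ.≟ 0ℤ
  ... | no fk≢0 = k , fk≢0
  ... | yes fk≡0 = ∑<-nonzero k f λ eq → ne (cong₂ _+_ eq fk≡0)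

-- Rotation of ℤ/p and its effect on the linear order of representatives

module Rotation (p : ℕ) .{{_ : NonZero p}} where

  open import Data.Integer using (+_; _+_; _-_; _*_)
  open ≡-Reasoning
  open IntegerSums

  rot : Fin p → Fin p
  rot a = suc (toℕ a) mod p

  rot^ : ℕ → Fin p → Fin p
  rot^ zero    a = a
  rot^ (suc j) a = rot (rot^ j a)

  toℕ-mod : ∀ x → toℕ (x mod p) ≡ x % p
  toℕ-mod x = Fin.toℕ-fromℕ< (m%n<n x p)

  toℕ-% : ∀ (a : Fin p) → toℕ a % p ≡ toℕ a
  toℕ-% a = m<n⇒m%n≡m (Fin.toℕ<n a)

  rot-mod : ∀ x → rot (x mod p) ≡ suc x mod p
  rot-mod x = Fin.toℕ-injective (begin
    toℕ (rot (x mod p))       ≡⟨ toℕ-mod (suc (toℕ (x mod p))) ⟩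
    suc (toℕ (x mod p)) % p   ≡⟨ cong (λ y → suc y % p) (toℕ-mod x) ⟩
    (1 ℕ.+ x % p) % p         ≡⟨ %-distribˡ-+ 1 (x % p) p ⟩
    (1 % p ℕ.+ x % p % p) % p ≡⟨ cong (λ y → (1 % p ℕ.+ y) % p) (m%n%n≡m%n x p) ⟩
    (1 % p ℕ.+ x % p) % p     ≡⟨ sym (%-distribˡ-+ 1 x p) ⟩
    suc x % p                 ≡⟨ sym (toℕ-mod (suc x)) ⟩
    toℕ (suc x mod p)         ∎)

  toℕ-mod-id : ∀ (a : Fin p) → toℕ a mod p ≡ a
  toℕ-mod-id a = Fin.toℕ-injective (trans (toℕ-mod (toℕ a)) (toℕ-% a))

  rot^-mod : ∀ j a → rot^ j a ≡ (j ℕ.+ toℕ a) mod p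
  rot^-mod zero    a = sym (toℕ-mod-id a)
  rot^-mod (suc j) a = trans (cong rot (rot^-mod j a)) (rot-mod (j ℕ.+ toℕ a))

  rot^-rot : ∀ j a → rot^ j (rot a) ≡ rot^ (suc j) a
  rot^-rot zero    a = refl
  rot^-rot (suc j) a = cong rot (rot^-rot j a)

  rot^-p : ∀ a → rot^ p a ≡ a
  rot^-p a = Fin.toℕ-injective (begin
    toℕ (rot^ p a)             ≡⟨ cong toℕ (rot^-mod p a) ⟩
    toℕ ((p ℕ.+ toℕ a) mod p)  ≡⟨ toℕ-mod (p ℕ.+ toℕ a) ⟩
    (p ℕ.+ toℕ a) % p          ≡⟨ cong (_% p) (ℕ.+-comm p (toℕ a)) ⟩
    (toℕ a ℕ.+ p) % p          ≡⟨ [m+n]%n≡m%n (toℕ a) p ⟩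
    toℕ a % p                  ≡⟨ toℕ-% a ⟩
    toℕ a                      ∎)

  rot^-pred-rot : ∀ a → rot^ (ℕ.pred p) (rot a) ≡ a
  rot^-pred-rot a = trans (rot^-rot (ℕ.pred p) a) (trans (cong (λ k → rot^ k a) (ℕ.suc-pred p)) (rot^-p a))

  origin : Fin p
  origin = 0 mod p

  rot^-origin : ∀ a → rot^ (toℕ a) origin ≡ a
  rot^-origin a = trans (rot^-mod (toℕ a) origin)
    (trans (cong (λ x → (toℕ a ℕ.+ x) mod p) (trans (toℕ-mod 0) (m<n⇒m%n≡m (ℕ.>-nonZero⁻¹ p))))
    (trans (cong (_mod p) (ℕ.+-identityʳ (toℕ a))) (toℕ-mod-id a)))

  ψ : Fin p → ℤ
  ψ a = + toℕ a

  data Position (a : Fin p) : Set where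
    inner : toℕ (rot a) ≡ suc (toℕ a) → Position a
    last  : suc (toℕ a) ≡ p → toℕ (rot a) ≡ 0 → Position a

  position : ∀ a → Position a
  position a with suc (toℕ a) ℕ.≟ p
  ... | yes eq = last eq (trans (toℕ-mod (suc (toℕ a))) (trans (cong (_% p) eq) (n%n≡0 p)))
  ... | no neq = inner (trans (toℕ-mod (suc (toℕ a))) (m<n⇒m%n≡m (ℕ.≤∧≢⇒< (Fin.toℕ<n a) neq)))

  wrap : Fin p → ℤ
  wrap a with position a
  ... | inner _  = 0ℤ
  ... | last _ _ = 1ℤ

  lt : ℕ → ℕ → ℤ
  lt x zero          = 0ℤ
  lt zero (suc y)    = 1ℤ
  lt (suc x) (suc y) = lt x y

  lt-< : ∀ {x y} → x ℕ.< y → lt x y ≡ 1ℤ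
  lt-< {zero}  {suc y} _         = refl
  lt-< {suc x} {suc y} (ℕ.s≤s l) = lt-< l

  lt-≥ : ∀ {x y} → y ℕ.≤ x → lt x y ≡ 0ℤ
  lt-≥ {_}     {zero}  _         = refl
  lt-≥ {suc x} {suc y} (ℕ.s≤s l) = lt-≥ l

  asc : Fin p → Fin p → ℤ
  asc a b = lt (toℕ a) (toℕ b)

  asc-refl : ∀ a → asc a a ≡ 0ℤ
  asc-refl a = lt-≥ {toℕ a} ℕ.≤-refl

  ψ-rot : ∀ a → ψ (rot a) ≡ ψ a + 1ℤ - + p * wrap a
  ψ-rot a with position a
  ... | inner eq = trans (cong +_ (trans eq (ℕ.+-comm 1 (toℕ a)))) (lem (ψ a) (+ p))
    where
    lem : ∀ x y → x + + 1 ≡ x + + 1 - y * + 0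
    lem = solve-∀
  ... | last eq₁ eq₂ = trans (cong +_ eq₂) (trans (lem (+ p)) (cong (λ x → x - + p * 1ℤ) (cong +_ (trans (sym eq₁) (ℕ.+-comm 1 (toℕ a))))))
    where
    lem : ∀ y → + 0 ≡ y - y * + 1
    lem = solve-∀

  -- Rotation breaks the order only in the passage from p - 1 to 0. The defect is a difference of
  -- values of `wrap` at the two arguments, so it cancels in a cyclic combination such as `carry`.
  asc-rot : ∀ a b → asc (rot a) (rot b) ≡ asc a b + wrap a - wrap b
  asc-rot a b with position a | position b
  ... | inner ea | inner eb rewrite ea | eb = lem (asc a b)
    where
    lem : ∀ x → x ≡ x + + 0 - + 0
    lem = solve-∀
  ... | inner ea | last eb eb′ rewrite ea | eb′ | lt-< {toℕ a} {toℕ b} (ℕ.≤-pred (subst₂ ℕ._≤_ (cong suc ea) (sym eb) (Fin.toℕ<n (rot a)))) = refl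
  ... | last ea ea′ | inner eb rewrite ea′ | eb
        | lt-≥ {toℕ a} {toℕ b} (ℕ.≤-pred (subst (suc (toℕ b) ℕ.≤_) (sym ea) (Fin.toℕ<n b))) = refl
  ... | last ea ea′ | last eb eb′ rewrite ea′ | eb′
        | lt-≥ {toℕ a} {toℕ b} (ℕ.≤-reflexive (ℕ.suc-injective (trans eb (sym ea)))) = refl

  -- The norm of `asc` over ℤ/p. By `D-formula` it is ψ a - ψ b modulo p, the standard 1-cocycle of
  -- ℤ/p up to sign.
  D : Fin p → Fin p → ℤ
  D a b = ∑< p (λ j → asc (rot^ j a) (rot^ j b))

  D-refl : ∀ a → D a a ≡ 0ℤ
  D-refl a = trans (∑<-cong p (λ j → asc-refl (rot^ j a))) (trans (∑<-const p 0ℤ) (ℤ.*-zeroʳ (+ p)))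

  private
    δ : Fin p → Fin p → ℤ
    δ a b = + p * asc a b + (ψ a - ψ b)

    δ-rot : ∀ a b → δ (rot a) (rot b) ≡ δ a b
    δ-rot a b rewrite asc-rot a b | ψ-rot a | ψ-rot b = lem (+ p) (asc a b) (wrap a) (wrap b) (ψ a) (ψ b)
      where
      lem : ∀ p B u v x y → p * (B + u - v) + ((x + + 1 - p * u) - (y + + 1 - p * v)) ≡ p * B + (x - y)
      lem = solve-∀

    δ-rot^ : ∀ j a b → δ (rot^ j a) (rot^ j b) ≡ δ a b
    δ-rot^ zero    a b = refl
    δ-rot^ (suc j) a b = trans (δ-rot (rot^ j a) (rot^ j b)) (δ-rot^ j a b)

    T : Fin p → ℤ
    T a = ∑< p (λ j → ψ (rot^ j a))

    T-rot : ∀ a → T (rot a) ≡ T a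
    T-rot a = trans (∑<-cong p (λ j → cong ψ (rot^-rot j a))) (∑<-cyclic p (λ j → ψ (rot^ j a)) (cong ψ (rot^-p a)))

    T-rot^ : ∀ j a → T (rot^ j a) ≡ T a
    T-rot^ zero    a = refl
    T-rot^ (suc j) a = trans (T-rot (rot^ j a)) (T-rot^ j a)

    T-const : ∀ a → T a ≡ T origin
    T-const a = trans (cong T (sym (rot^-origin a))) (T-rot^ (toℕ a) origin)

  -- p [a<b] + a - b is invariant under simultaneous rotation; averaging it over all rotations kills a - b.
  D-formula : ∀ a b → D a b ≡ + p * asc a b + (ψ a - ψ b)
  D-formula a b = sym (ℤ.*-cancelˡ-≡ (+ p) (δ a b) (D a b) (begin
    + p * δ a b                                                    ≡⟨ sym (∑<-const p (δ a b)) ⟩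
    ∑< p (λ _ → δ a b)                                             ≡⟨ ∑<-cong p (λ j → sym (δ-rot^ j a b)) ⟩
    ∑< p (λ j → δ (rot^ j a) (rot^ j b))                           ≡⟨ ∑<-cong p (λ j → lem (+ p * asc (rot^ j a) (rot^ j b)) (ψ (rot^ j a)) (ψ (rot^ j b))) ⟩
    ∑< p (λ j → + p * asc (rot^ j a) (rot^ j b) - (ψ (rot^ j b) - ψ (rot^ j a)))
                                                                   ≡⟨ ∑<-sub p (λ j → + p * asc (rot^ j a) (rot^ j b)) (λ j → ψ (rot^ j b) - ψ (rot^ j a)) ⟩
    ∑< p (λ j → + p * asc (rot^ j a) (rot^ j b)) - ∑< p (λ j → ψ (rot^ j b) - ψ (rot^ j a))
      ≡⟨ cong₂ _-_ (∑<-*ˡ p (+ p) (λ j → asc (rot^ j a) (rot^ j b))) (trans (∑<-sub p (λ j → ψ (rot^ j b)) (λ j → ψ (rot^ j a))) (cong₂ _-_ (T-const b) (T-const a))) ⟩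
    + p * D a b - (T origin - T origin)                                ≡⟨ lem₂ (+ p * D a b) (T origin) ⟩
    + p * D a b                                                    ∎))
    where
    lem : ∀ x a b → x + (a - b) ≡ x - (b - a)
    lem = solve-∀
    lem₂ : ∀ x t → x - (t - t) ≡ x
    lem₂ = solve-∀

-- Words as simplices of a join, and their coboundary operator

module Word {A : Set} where

  open import Data.Integer using (+_; _+_; _-_; _*_)
  open ≡-Reasoning
  open IntegerSums

  Word : ℕ → Set
  Word n = Vec (Maybe A) n

  size : ∀ {n} → Word n → ℕ
  size []            = 0
  size (nothing ∷ w) = size w
  size (just _ ∷ w)  = suc (size w)

  infix 4 _⋖_
  data _⋖_ : ∀ {n} → Word n → Word n → Set where
    here  : ∀ {n x} {w : Word n} → nothing ∷ w ⋖ just x ∷ w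
    there : ∀ {n y} {v w : Word n} → v ⋖ w → y ∷ v ⋖ y ∷ w

  ⋖-size : ∀ {n} {v w : Word n} → v ⋖ w → size w ≡ suc (size v)
  ⋖-size here                        = refl
  ⋖-size (there {y = nothing} v⋖w) = ⋖-size v⋖w
  ⋖-size (there {y = just _} v⋖w)  = cong suc (⋖-size v⋖w)

  ⋖-pred : ∀ {n m} {v w : Word n} → v ⋖ w → size w ≡ suc m → size v ≡ m
  ⋖-pred v⋖w eq = ℕ.suc-injective (trans (sym (⋖-size v⋖w)) eq)

  -- Words are the simplices of the n-fold join of the discrete set A, and ∂ is the coboundary of cochains on it.
  ∂ : ∀ {n} → (Word n → ℤ) → Word n → ℤ
  ∂ F []            = 0ℤ
  ∂ F (nothing ∷ w) = ∂ (F ∘ (nothing ∷_)) w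
  ∂ F (just x ∷ w)  = F (nothing ∷ w) - ∂ (F ∘ (just x ∷_)) w

  ∂-cong : ∀ {n} {F G : Word n → ℤ} w → (∀ v → v ⋖ w → F v ≡ G v) → ∂ F w ≡ ∂ G w
  ∂-cong []            eq = refl
  ∂-cong (nothing ∷ w) eq = ∂-cong w λ v v⋖w → eq (nothing ∷ v) (there v⋖w)
  ∂-cong (just x ∷ w)  eq = cong₂ _-_ (eq (nothing ∷ w) here) (∂-cong w λ v v⋖w → eq (just x ∷ v) (there v⋖w))

  ∂-sub : ∀ {n} (F G : Word n → ℤ) w → ∂ (λ v → F v - G v) w ≡ ∂ F w - ∂ G w
  ∂-sub F G []            = refl
  ∂-sub F G (nothing ∷ w) = ∂-sub _ _ w
  ∂-sub F G (just x ∷ w)  = trans (cong (λ z → F (nothing ∷ w) - G (nothing ∷ w) - z) (∂-sub _ _ w)) (lem (F (nothing ∷ w)) (G (nothing ∷ w)) (∂ (F ∘ (just x ∷_)) w) (∂ (G ∘ (just x ∷_)) w))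
    where
    lem : ∀ a b c d → a - b - (c - d) ≡ a - c - (b - d)
    lem = solve-∀

  ∂-*ʳ : ∀ {n} (F : Word n → ℤ) x w → ∂ (λ v → F v * x) w ≡ ∂ F w * x
  ∂-*ʳ F x []            = refl
  ∂-*ʳ F x (nothing ∷ w) = ∂-*ʳ _ x w
  ∂-*ʳ F x (just y ∷ w)  = trans (cong (λ z → F (nothing ∷ w) * x - z) (∂-*ʳ _ x w)) (lem (F (nothing ∷ w)) x (∂ (F ∘ (just y ∷_)) w))
    where
    lem : ∀ a b c → a * b - c * b ≡ (a - c) * b
    lem = solve-∀

  ∂-0 : ∀ {n} (w : Word n) → ∂ (λ _ → 0ℤ) w ≡ 0ℤ
  ∂-0 w = trans (∂-*ʳ (λ _ → 0ℤ) 0ℤ w) (ℤ.*-zeroʳ (∂ (λ _ → 0ℤ) w))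

  ∂-+ : ∀ {n} (F G : Word n → ℤ) w → ∂ (λ v → F v + G v) w ≡ ∂ F w + ∂ G w
  ∂-+ F G w = begin
    ∂ (λ v → F v + G v) w                    ≡⟨ ∂-cong w (λ v _ → lem (F v) (G v)) ⟩
    ∂ (λ v → F v - (0ℤ - G v)) w             ≡⟨ ∂-sub F (λ v → 0ℤ - G v) w ⟩
    ∂ F w - ∂ (λ v → 0ℤ - G v) w             ≡⟨ cong (λ x → ∂ F w - x) (∂-sub (λ _ → 0ℤ) G w) ⟩
    ∂ F w - (∂ (λ _ → 0ℤ) w - ∂ G w)         ≡⟨ cong (λ x → ∂ F w - (x - ∂ G w)) (∂-0 w) ⟩
    ∂ F w - (0ℤ - ∂ G w)                     ≡⟨ sym (lem (∂ F w) (∂ G w)) ⟩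
    ∂ F w + ∂ G w                            ∎
    where
    lem : ∀ a b → a + b ≡ a - (0ℤ - b)
    lem = solve-∀

  ∂-∑< : ∀ {n} k (F : ℕ → Word n → ℤ) w → ∂ (λ v → ∑< k (λ j → F j v)) w ≡ ∑< k (λ j → ∂ (F j) w)
  ∂-∑< zero    F w = ∂-0 w
  ∂-∑< (suc k) F w = trans (∂-+ (λ v → ∑< k (λ j → F j v)) (F k) w) (cong (_+ ∂ (F k) w) (∂-∑< k F w))

  ∂∂ : ∀ {n} (F : Word n → ℤ) w → ∂ (∂ F) w ≡ 0ℤ
  ∂∂ F []            = refl
  ∂∂ F (nothing ∷ w) = ∂∂ _ w
  ∂∂ F (just x ∷ w)  = begin
    ∂ F₀ w - ∂ (λ v → F₀ v - ∂ F₁ v) w ≡⟨ cong (λ z → ∂ F₀ w - z) (∂-sub F₀ (∂ F₁) w) ⟩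
    ∂ F₀ w - (∂ F₀ w - ∂ (∂ F₁) w)     ≡⟨ cong (λ z → ∂ F₀ w - (∂ F₀ w - z)) (∂∂ F₁ w) ⟩
    ∂ F₀ w - (∂ F₀ w - 0ℤ)             ≡⟨ lem (∂ F₀ w) ⟩
    0ℤ                                 ∎
    where
    F₀ = F ∘ (nothing ∷_)
    F₁ = F ∘ (just x ∷_)
    lem : ∀ a → a - (a - 0ℤ) ≡ 0ℤ
    lem = solve-∀

  odd : ℕ → ℤ
  odd zero    = 0ℤ
  odd (suc n) = 1ℤ - odd n

  -- The signs of the facets alternate and cancel in pairs. At size 2 this makes the constant
  -- cochain 1 a cocycle, where the powers `G` start.
  ∂-1 : ∀ {n} (w : Word n) → ∂ (λ _ → 1ℤ) w ≡ odd (size w)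
  ∂-1 []            = refl
  ∂-1 (nothing ∷ w) = ∂-1 w
  ∂-1 (just _ ∷ w)  = cong (λ z → 1ℤ - z) (∂-1 w)

  -- Iterated, this turns a nonzero value of a cochain into a descending chain of words.
  ∂-nonzero : ∀ {n} (F : Word n → ℤ) w → ∂ F w ≢ 0ℤ → ∃ λ v → v ⋖ w × F v ≢ 0ℤ
  ∂-nonzero F []            ne = contradiction refl ne
  ∂-nonzero F (nothing ∷ w) ne with ∂-nonzero _ w ne
  ... | v , v⋖w , Fv≢0 = nothing ∷ v , there v⋖w , Fv≢0
  ∂-nonzero F (just x ∷ w)  ne with F (nothing ∷ w) ℤ.≟ 0ℤ
  ... | no F≢0 = nothing ∷ w , here , F≢0
  ... | yes F≡0 with ∂-nonzero (F ∘ (just x ∷_)) w (λ eq → ne (cong₂ _-_ F≡0 eq))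
  ...   | v , v⋖w , Fv≢0 = just x ∷ v , there v⋖w , Fv≢0

-- The Tucker lemma for ℤ/p

module ZpTucker (p : ℕ) .{{_ : NonZero p}} (1<p : 1 ℕ.< p) where

  open import Data.Integer using (+_; _+_; _-_; _*_; -_)
  open ≡-Reasoning
  open IntegerSums
  open Rotation p
  open Word {Fin p}

  infix 4 _≈_
  -- Congruence modulo `p`, with the quotient as data, so that its closure properties become ring
  -- identities.
  record _≈_ (x y : ℤ) : Set where
    constructor _by_
    field
      quot : ℤ
      proof : x ≡ y + quot * + p

  ≡⇒≈ : ∀ {x y} → x ≡ y → x ≈ y
  ≡⇒≈ {x} refl = 0ℤ by lem x (+ p)
    where
    lem : ∀ x P → x ≡ x + 0ℤ * P
    lem = solve-∀

  ≈-trans : ∀ {x y z} → x ≈ y → y ≈ z → x ≈ z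
  ≈-trans {z = z} (i by refl) (j by refl) = (i + j) by lem z i j (+ p)
    where
    lem : ∀ z i j P → z + j * P + i * P ≡ z + (i + j) * P
    lem = solve-∀

  +-cong≈ : ∀ {x x′ y y′} → x ≈ x′ → y ≈ y′ → x + y ≈ x′ + y′
  +-cong≈ {x′ = x} {y′ = y} (i by refl) (j by refl) = (i + j) by lem x y i j (+ p)
    where
    lem : ∀ x y i j P → x + i * P + (y + j * P) ≡ x + y + (i + j) * P
    lem = solve-∀

  -‿cong≈ : ∀ {x x′ y y′} → x ≈ x′ → y ≈ y′ → x - y ≈ x′ - y′
  -‿cong≈ {x′ = x} {y′ = y} (i by refl) (j by refl) = (i - j) by lem x y i j (+ p)
    where
    lem : ∀ x y i j P → x + i * P - (y + j * P) ≡ x - y + (i - j) * P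
    lem = solve-∀

  ∑<-cong≈ : ∀ k {f g : ℕ → ℤ} → (∀ j → f j ≈ g j) → ∑< k f ≈ ∑< k g
  ∑<-cong≈ zero    eq = ≡⇒≈ refl
  ∑<-cong≈ (suc k) eq = +-cong≈ (∑<-cong≈ k eq) (eq k)

  -- Otherwise `p` would divide 1, against `1<p`.
  ≈1⇒≢0 : ∀ {x} → x ≈ 1ℤ → x ≢ 0ℤ
  ≈1⇒≢0 {x} (i by eq) refl = ℕ.<⇒≢ 1<p (sym p≡1)
    where
    lem : ∀ i P → + 0 ≡ 1ℤ + i * P → 1ℤ ≡ (- i) * P
    lem i P e = trans (lem₁ i P) (trans (cong (_+ (- i) * P) (sym e)) (ℤ.+-identityˡ ((- i) * P)))
      where
      lem₁ : ∀ i P → 1ℤ ≡ 1ℤ + i * P + (- i) * P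
      lem₁ = solve-∀
    p≡1 : p ≡ 1
    p≡1 = ℕ.m*n≡1⇒n≡1 ℤ.∣ - i ∣ p (trans (sym (ℤ.abs-* (- i) (+ p))) (cong ℤ.∣_∣ (sym (lem i (+ p) eq))))

  rotw : ∀ {n} → Word n → Word n
  rotw []            = []
  rotw (nothing ∷ w) = nothing ∷ rotw w
  rotw (just x ∷ w)  = just (rot x) ∷ rotw w

  rotw^ : ∀ {n} → ℕ → Word n → Word n
  rotw^ zero    w = w
  rotw^ (suc j) w = rotw (rotw^ j w)

  rotw^-rotw : ∀ {n} j (w : Word n) → rotw^ j (rotw w) ≡ rotw^ (suc j) w
  rotw^-rotw zero    w = refl
  rotw^-rotw (suc j) w = cong rotw (rotw^-rotw j w)

  rotw^-[] : ∀ j → rotw^ j [] ≡ []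
  rotw^-[] zero    = refl
  rotw^-[] (suc j) = cong rotw (rotw^-[] j)

  rotw^-nothing : ∀ {n} j (w : Word n) → rotw^ j (nothing ∷ w) ≡ nothing ∷ rotw^ j w
  rotw^-nothing zero    w = refl
  rotw^-nothing (suc j) w = cong rotw (rotw^-nothing j w)

  rotw^-just : ∀ {n} j x (w : Word n) → rotw^ j (just x ∷ w) ≡ just (rot^ j x) ∷ rotw^ j w
  rotw^-just zero    x w = refl
  rotw^-just (suc j) x w = cong rotw (rotw^-just j x w)

  rotw^-p : ∀ {n} (w : Word n) → rotw^ p w ≡ w
  rotw^-p []            = rotw^-[] p
  rotw^-p (nothing ∷ w) = trans (rotw^-nothing p w) (cong (nothing ∷_) (rotw^-p w))
  rotw^-p (just x ∷ w)  = trans (rotw^-just p x w) (cong₂ (λ y v → just y ∷ v) (rot^-p x) (rotw^-p w))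

  size-rotw : ∀ {n} (w : Word n) → size (rotw w) ≡ size w
  size-rotw []            = refl
  size-rotw (nothing ∷ w) = size-rotw w
  size-rotw (just _ ∷ w)  = cong suc (size-rotw w)

  size-rotw^ : ∀ {n} j (w : Word n) → size (rotw^ j w) ≡ size w
  size-rotw^ zero    w = refl
  size-rotw^ (suc j) w = trans (size-rotw (rotw^ j w)) (size-rotw^ j w)

  ∂-rotw : ∀ {n} (F : Word n → ℤ) w → ∂ F (rotw w) ≡ ∂ (F ∘ rotw) w
  ∂-rotw F []            = refl
  ∂-rotw F (nothing ∷ w) = ∂-rotw _ w
  ∂-rotw F (just x ∷ w)  = cong (λ z → F (nothing ∷ rotw w) - z) (∂-rotw _ w)

  ∂-rotw^ : ∀ {n} j (F : Word n → ℤ) w → ∂ F (rotw^ j w) ≡ ∂ (F ∘ rotw^ j) w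
  ∂-rotw^ zero    F w = refl
  ∂-rotw^ (suc j) F w = trans (∂-rotw F (rotw^ j w)) (∂-rotw^ j (F ∘ rotw) w)

  even? : ℕ → Bool
  even? zero    = true
  even? (suc n) = not (even? n)

  -- The group ring elements rot - 1 and 1 + rot + ... + rotᵖ⁻¹, which alternate in the periodic
  -- resolution of a cyclic group.
  τσ : ∀ {n} → Bool → (Word n → ℤ) → Word n → ℤ
  τσ true  F w = F (rotw w) - F w
  τσ false F w = ∑< p λ j → F (rotw^ j w)

  -- The identity at index 0 lets the recursion for `h` start from the empty word and produce a
  -- single point as h₁.
  op : ℕ → ∀ {n} → (Word n → ℤ) → Word n → ℤ
  op zero    F = F
  op (suc m) F = τσ (even? m) F

  -- h n is evaluation of cochains at a chain hₙ, where h₁ is a point and hₙ₊₁ is a cone over (rot - 1) hₙ for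
  -- odd n and over (1 + rot + … + rotᵖ⁻¹) hₙ for even n. As these two operators annihilate each other, the
  -- boundary of hₙ₊₁ is the base of the cone (h-∂).
  h : ∀ n → (Word n → ℤ) → ℤ
  h zero    F = F []
  h (suc n) F = h n (op n (F ∘ (just origin ∷_)))

  op-cong≈ : ∀ m {n k} {F G : Word n → ℤ} → (∀ w → size w ≡ k → F w ≈ G w) → ∀ w → size w ≡ k → op m F w ≈ op m G w
  op-cong≈ zero    eq w sz = eq w sz
  op-cong≈ (suc m) eq w sz with even? m
  ... | true  = -‿cong≈ (eq (rotw w) (trans (size-rotw w) sz)) (eq w sz)
  ... | false = ∑<-cong≈ p λ j → eq (rotw^ j w) (trans (size-rotw^ j w) sz)

  -- The chain hₙ is supported on words of size n. The restriction to this size matters, because the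
  -- identities for `G` and `R` hold in one size each.
  h-cong≈ : ∀ n {F G : Word n → ℤ} → (∀ w → size w ≡ n → F w ≈ G w) → h n F ≈ h n G
  h-cong≈ zero    eq = eq [] refl
  h-cong≈ (suc n) eq = h-cong≈ n (op-cong≈ n (λ w sz → eq (just origin ∷ w) (cong suc sz)))

  op-sub : ∀ m {n} (F G : Word n → ℤ) w → op m (λ v → F v - G v) w ≡ op m F w - op m G w
  op-sub zero    F G w = refl
  op-sub (suc m) F G w with even? m
  ... | true  = lem (F (rotw w)) (G (rotw w)) (F w) (G w)
    where
    lem : ∀ a b c d → a - b - (c - d) ≡ a - c - (b - d)
    lem = solve-∀
  ... | false = ∑<-sub p _ _

  h-sub : ∀ n (F G : Word n → ℤ) → h n (λ v → F v - G v) ≈ h n F - h n G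
  h-sub zero    F G = ≡⇒≈ refl
  h-sub (suc n) F G = ≈-trans (h-cong≈ n (λ w _ → ≡⇒≈ (op-sub n (F ∘ (just origin ∷_)) (G ∘ (just origin ∷_)) w))) (h-sub n _ _)

  h-0 : ∀ n → h n (λ _ → 0ℤ) ≈ 0ℤ
  h-0 n = ≈-trans (h-sub n (λ _ → 0ℤ) (λ _ → 0ℤ)) (≡⇒≈ (ℤ.+-inverseʳ (h n λ _ → 0ℤ)))

  op-∂ : ∀ m {n} (F : Word n → ℤ) w → op m (∂ F) w ≡ ∂ (op m F) w
  op-∂ zero    F w = refl
  op-∂ (suc m) F w with even? m
  ... | true  = trans (cong (_- ∂ F w) (∂-rotw F w)) (sym (∂-sub (F ∘ rotw) F w))
  ... | false = trans (∑<-cong p λ j → ∂-rotw^ j F w) (sym (∂-∑< p (λ j → F ∘ rotw^ j) w))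

  op-nothing : ∀ m {n} (F : Word (suc n) → ℤ) w → op m F (nothing ∷ w) ≡ op m (F ∘ (nothing ∷_)) w
  op-nothing zero    F w = refl
  op-nothing (suc m) F w with even? m
  ... | true  = refl
  ... | false = ∑<-cong p λ j → cong F (rotw^-nothing j w)

  ∑-orbit-rotw : ∀ {n} (F : Word n → ℤ) w → ∑< p (λ j → F (rotw^ (suc j) w)) ≡ ∑< p (λ j → F (rotw^ j w))
  ∑-orbit-rotw F w = ∑<-cyclic p (λ j → F (rotw^ j w)) (cong F (rotw^-p w))

  -- In either order, because a sum over a full orbit is unchanged by one more rotation.
  στ≡0 : ∀ b {n} (F : Word n → ℤ) w → τσ b (τσ (not b) F) w ≡ 0ℤ
  στ≡0 true  F w = ℤ.i≡j⇒i-j≡0 (trans (∑<-cong p λ j → cong F (rotw^-rotw j w)) (∑-orbit-rotw F w))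
  στ≡0 false F w = trans (∑<-sub p (λ j → F (rotw^ (suc j) w)) (λ j → F (rotw^ j w))) (ℤ.i≡j⇒i-j≡0 (∑-orbit-rotw F w))

  op-op : ∀ n (F : Word n → ℤ) w → op n (op (suc n) F) w ≡ 0ℤ
  -- The empty word is fixed by `rotw`, so rot - 1 already vanishes on it.
  op-op zero    F [] = ℤ.+-inverseʳ (F [])
  op-op (suc n) F w  = στ≡0 (even? n) F w

  h-∂ : ∀ n (F : Word (suc n) → ℤ) → h (suc n) (∂ F) ≈ h n (op n (F ∘ (nothing ∷_)))
  h-∂ n F = ≈-trans (h-cong≈ n (λ w _ → ≡⇒≈ (op-sub n F₀ (∂ F₁) w)))
           (≈-trans (h-sub n (op n F₀) (op n (∂ F₁)))
           (≈-trans (-‿cong≈ {h n (op n F₀)} (≡⇒≈ refl) (vanish n F₁))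
                    (≡⇒≈ (ℤ.+-identityʳ (h n (op n F₀))))))
    where
    F₀ = F ∘ (nothing ∷_)
    F₁ = F ∘ (just origin ∷_)
    -- The boundary of a cone is its base minus the cone over the boundary of the base; this removes
    -- the second part. After `∂` is moved past `op`, `h-∂` one dimension lower leaves the composite
    -- of two consecutive operators.
    vanish : ∀ n (F : Word n → ℤ) → h n (op n (∂ F)) ≈ 0ℤ
    vanish zero    F = ≡⇒≈ refl
    vanish (suc n) F =
      ≈-trans (h-cong≈ (suc n) (λ w _ → ≡⇒≈ (op-∂ (suc n) F w)))
     (≈-trans (h-∂ n (op (suc n) F))
     (≈-trans (h-cong≈ n (λ w sz → op-cong≈ n (λ v _ → ≡⇒≈ (op-nothing (suc n) F v)) w sz))
     (≈-trans (h-cong≈ n (λ w _ → ≡⇒≈ (op-op n (F ∘ (nothing ∷_)) w)))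
              (h-0 n))))

  op-nonzero : ∀ m {n} (F : Word n → ℤ) w → op m F w ≢ 0ℤ → ∃ λ v → size v ≡ size w × F v ≢ 0ℤ
  op-nonzero zero    F w ne = w , refl , ne
  op-nonzero (suc m) F w ne with even? m
  ... | false with ∑<-nonzero p _ ne
  ...   | j , Fj≢0 = rotw^ j w , size-rotw^ j w , Fj≢0
  op-nonzero (suc m) F w ne | true with F w ℤ.≟ 0ℤ
  ... | no Fw≢0 = w , refl , Fw≢0
  ... | yes Fw≡0 = rotw w , size-rotw w , λ eq → ne (cong₂ _-_ eq Fw≡0)

  h-nonzero : ∀ n (F : Word n → ℤ) → h n F ≢ 0ℤ → ∃ λ w → size w ≡ n × F w ≢ 0ℤ
  h-nonzero zero    F ne = [] , refl , ne
  h-nonzero (suc n) F ne with h-nonzero n _ ne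
  ... | w , sz , ne₁ with op-nonzero n (F ∘ (just origin ∷_)) w ne₁
  ...   | v , sz′ , ne₂ = just origin ∷ v , cong suc (trans sz′ sz) , ne₂

  -- The empty word is excepted: every rotation fixes it, while `rot` has no fixed point when p > 1.
  Equivariant : ∀ {n} → (Word n → Fin p) → Set
  Equivariant s = ∀ w → 0 ℕ.< size w → s (rotw w) ≡ rot (s w)

  module _ {n} (s : Word n → Fin p) where

    -- G l evaluates, on the barycentric subdivision of the simplex w of dimension 2l, the l-th cup power of
    -- the 2-cocycle carry pulled back along s; see G-carry for this form, from which the equality of
    -- consecutive signs makes a summand vanish.
    Q : (Word n → ℤ) → Word n → ℤ
    Q G w = ∂ (λ v → G v * asc (s v) (s w)) w

    G : ℕ → Word n → ℤ
    G zero    w = 1ℤ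
    G (suc l) w = ∂ (Q (G l)) w

    -- The odd-dimensional companion of `G`: the same cup power multiplied by the 1-cochain `D`
    -- pulled back along `s`.
    R : ℕ → Word n → ℤ
    R l w = ∂ (λ v → G l v * D (s v) (s w)) w

    ∂-G : ∀ l w → size w ≡ suc (suc (l ℕ.* 2)) → ∂ (G l) w ≡ 0ℤ
    ∂-G zero    w sz = trans (∂-1 w) (cong odd sz)
    ∂-G (suc l) w sz = ∂∂ (Q (G l)) w

    -- The coboundary of `asc`. It is rotation invariant by `asc-rot`, although `asc` is not.
    carry : Fin p → Fin p → Fin p → ℤ
    carry a b c = asc a b + asc b c - asc a c

    -- Of the three terms of `carry`, the one in `asc (s v) (s w)` is multiplied by `∂ (G l) v`,
    -- which is 0, and the one in `asc (s u) (s w)` is killed by `∂∂`; the first term is the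
    -- definition of `G (suc l)`.
    G-carry : ∀ l w → size w ≡ suc (suc (suc (l ℕ.* 2))) →
              G (suc l) w ≡ ∂ (λ v → ∂ (λ u → G l u * carry (s u) (s v) (s w)) v) w
    G-carry l w sz = sym (begin
      ∂ (λ v → ∂ (λ u → G l u * carry (s u) (s v) (s w)) v) w
        ≡⟨ ∂-cong w (λ v v⋖w → begin
             ∂ (λ u → G l u * carry (s u) (s v) (s w)) v
               ≡⟨ ∂-cong v (λ u _ → dist (G l u) (asc (s u) (s v)) (asc (s v) (s w)) (asc (s u) (s w))) ⟩
             ∂ (λ u → G l u * asc (s u) (s v) + (G l u * asc (s v) (s w) - G l u * asc (s u) (s w))) v
               ≡⟨ trans (∂-+ _ _ v) (cong (λ z → Q (G l) v + z) (∂-sub _ _ v)) ⟩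
             Q (G l) v + (∂ (λ u → G l u * asc (s v) (s w)) v - X v)
               ≡⟨ cong (λ z → Q (G l) v + (z - X v)) (trans (∂-*ʳ (G l) (asc (s v) (s w)) v) (cong (_* asc (s v) (s w)) (∂-G l v (⋖-pred v⋖w sz)))) ⟩
             Q (G l) v + (0ℤ * asc (s v) (s w) - X v)
               ≡⟨ drop (Q (G l) v) (asc (s v) (s w)) (X v) ⟩
             Q (G l) v - X v ∎) ⟩
      ∂ (λ v → Q (G l) v - X v) w
        ≡⟨ ∂-sub (Q (G l)) X w ⟩
      G (suc l) w - ∂ X w
        ≡⟨ trans (cong (λ z → G (suc l) w - z) (∂∂ (λ u → G l u * asc (s u) (s w)) w)) (ℤ.+-identityʳ (G (suc l) w)) ⟩
      G (suc l) w ∎)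
      where
      X : Word n → ℤ
      X v = ∂ (λ u → G l u * asc (s u) (s w)) v
      dist : ∀ g a b c → g * (a + b - c) ≡ g * a + (g * b - g * c)
      dist = solve-∀
      drop : ∀ q b x → q + (0ℤ * b - x) ≡ q - x
      drop = solve-∀

    data Alternating : Word n → Set where
      single : ∀ {w} → size w ≡ 1 → Alternating w
      extend : ∀ {v w} → Alternating v → v ⋖ w → s v ≢ s w → Alternating w

    carry-left : ∀ a b c → carry a b c ≢ 0ℤ → a ≢ b
    carry-left a b c ne refl = ne (trans (cong (λ z → z + asc a c - asc a c) (asc-refl a)) (lem (asc a c)))
      where
      lem : ∀ x → 0ℤ + x - x ≡ 0ℤ
      lem = solve-∀

    carry-right : ∀ a b c → carry a b c ≢ 0ℤ → b ≢ c
    carry-right a b c ne refl = ne (trans (cong (λ z → asc a b + z - asc a b) (asc-refl b)) (lem (asc a b)))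
      where
      lem : ∀ x → x + 0ℤ - x ≡ 0ℤ
      lem = solve-∀

    *-nonzero : ∀ {x y} → x * y ≢ 0ℤ → x ≢ 0ℤ × y ≢ 0ℤ
    *-nonzero {x} {y} ne = (λ eq → ne (trans (cong (_* y) eq) (ℤ.*-zeroˡ y))) , (λ eq → ne (trans (cong (x *_) eq) (ℤ.*-zeroʳ x)))

    G-alternating : ∀ l w → size w ≡ suc (l ℕ.* 2) → G l w ≢ 0ℤ → Alternating w
    G-alternating zero    w sz ne = single sz
    G-alternating (suc l) w sz ne with ∂-nonzero _ w (ne ∘ trans (G-carry l w sz))
    ... | v , v⋖w , ne₁ with ∂-nonzero _ v ne₁
    ...   | u , u⋖v , ne₂ with *-nonzero {G l u} ne₂
    ...     | Gu≢0 , carry≢0 =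
      extend (extend (G-alternating l u (⋖-pred u⋖v (⋖-pred v⋖w sz)) Gu≢0) u⋖v
                     (carry-left (s u) (s v) (s w) carry≢0))
             v⋖w (carry-right (s u) (s v) (s w) carry≢0)

    R-alternating : ∀ l w → size w ≡ suc (suc (l ℕ.* 2)) → R l w ≢ 0ℤ → Alternating w
    R-alternating l w sz ne with ∂-nonzero _ w ne
    ... | v , v⋖w , ne₁ with *-nonzero {G l v} ne₁
    ...   | Gv≢0 , D≢0 = extend (G-alternating l v (⋖-pred v⋖w sz) Gv≢0) v⋖w λ eq → D≢0 (trans (cong (λ a → D a (s w)) eq) (D-refl (s w)))

    size>0 : ∀ (w : Word n) {m} → size w ≡ suc m → 0 ℕ.< size w
    size>0 w eq = subst (0 ℕ.<_) (sym eq) (ℕ.s≤s ℕ.z≤n)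

    module _ (equi : Equivariant s) where

      s-rotw^ : ∀ j w → 0 ℕ.< size w → s (rotw^ j w) ≡ rot^ j (s w)
      s-rotw^ zero    w pos = refl
      s-rotw^ (suc j) w pos = trans (equi (rotw^ j w) (subst (0 ℕ.<_) (sym (size-rotw^ j w)) pos)) (cong rot (s-rotw^ j w pos))

      -- Proved together with `Q-rotw`. By `asc-rot`, rotation alters `Q` through `wrap` at the two
      -- ends: the end at `w` is multiplied by `∂ (G l) w`, which is 0, and the end at `v` leaves a
      -- coboundary. One more `∂` kills the latter, so `G` is invariant.
      G-rotw : ∀ l w → size w ≡ suc (l ℕ.* 2) → G l (rotw w) ≡ G l w
      Q-rotw : ∀ l w → size w ≡ suc (suc (l ℕ.* 2)) →
               Q (G l) (rotw w) ≡ Q (G l) w - ∂ (λ v → G l v * (- wrap (s v))) w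

      Q-rotw l w sz = begin
        ∂ (λ v → G l v * asc (s v) (s (rotw w))) (rotw w)
          ≡⟨ ∂-rotw (λ v → G l v * asc (s v) (s (rotw w))) w ⟩
        ∂ (λ v → G l (rotw v) * asc (s (rotw v)) (s (rotw w))) w
          ≡⟨ ∂-cong w (λ v v⋖w → begin
               G l (rotw v) * asc (s (rotw v)) (s (rotw w))
                 ≡⟨ cong₂ _*_ (G-rotw l v (⋖-pred v⋖w sz))
                              (trans (cong₂ asc (equi v (size>0 v (⋖-pred v⋖w sz))) (equi w (size>0 w sz))) (asc-rot (s v) (s w))) ⟩
               G l v * (asc (s v) (s w) + wrap (s v) - wrap (s w))
                 ≡⟨ dist (G l v) (asc (s v) (s w)) (wrap (s v)) (wrap (s w)) ⟩
               G l v * asc (s v) (s w) - (G l v * (- wrap (s v)) - G l v * (- wrap (s w))) ∎) ⟩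
        ∂ (λ v → G l v * asc (s v) (s w) - (G l v * (- wrap (s v)) - G l v * (- wrap (s w)))) w
          ≡⟨ trans (∂-sub _ _ w) (cong (λ z → Q (G l) w - z) (∂-sub _ _ w)) ⟩
        Q (G l) w - (Y - ∂ (λ v → G l v * (- wrap (s w))) w)
          ≡⟨ cong (λ z → Q (G l) w - (Y - z)) (trans (∂-*ʳ (G l) (- wrap (s w)) w) (cong (_* (- wrap (s w))) (∂-G l w sz))) ⟩
        Q (G l) w - (Y - 0ℤ * (- wrap (s w)))
          ≡⟨ drop (Q (G l) w) Y (wrap (s w)) ⟩
        Q (G l) w - Y ∎
        where
        Y = ∂ (λ v → G l v * (- wrap (s v))) w
        dist : ∀ g a b c → g * (a + b - c) ≡ g * a - (g * (- b) - g * (- c))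
        dist = solve-∀
        drop : ∀ q y x → q - (y - 0ℤ * (- x)) ≡ q - y
        drop = solve-∀

      G-rotw zero    w sz = refl
      G-rotw (suc l) w sz = begin
        ∂ (Q (G l)) (rotw w)                ≡⟨ ∂-rotw (Q (G l)) w ⟩
        ∂ (Q (G l) ∘ rotw) w                ≡⟨ ∂-cong w (λ v v⋖w → Q-rotw l v (⋖-pred v⋖w sz)) ⟩
        ∂ (λ v → Q (G l) v - ∂ Y v) w       ≡⟨ ∂-sub (Q (G l)) (∂ Y) w ⟩
        ∂ (Q (G l)) w - ∂ (∂ Y) w           ≡⟨ cong (λ z → ∂ (Q (G l)) w - z) (∂∂ Y w) ⟩
        ∂ (Q (G l)) w - 0ℤ                  ≡⟨ ℤ.+-identityʳ (∂ (Q (G l)) w) ⟩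
        ∂ (Q (G l)) w                       ∎
        where
        Y : Word n → ℤ
        Y v = G l v * (- wrap (s v))

      G-rotw^ : ∀ l j w → size w ≡ suc (l ℕ.* 2) → G l (rotw^ j w) ≡ G l w
      G-rotw^ l zero    w sz = refl
      G-rotw^ l (suc j) w sz = trans (G-rotw l (rotw^ j w) (trans (size-rotw^ j w) sz)) (G-rotw^ l j w sz)

      -- As `G l` is invariant, the sum over the orbit acts on the factor `asc` alone and makes it
      -- `D`.
      Q-orbit : ∀ l w → size w ≡ suc (suc (l ℕ.* 2)) → ∑< p (λ j → Q (G l) (rotw^ j w)) ≡ R l w
      Q-orbit l w sz = begin
        ∑< p (λ j → Q (G l) (rotw^ j w))
          ≡⟨ ∑<-cong p (λ j → ∂-rotw^ j (λ v → G l v * asc (s v) (s (rotw^ j w))) w) ⟩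
        ∑< p (λ j → ∂ (λ v → G l (rotw^ j v) * asc (s (rotw^ j v)) (s (rotw^ j w))) w)
          ≡⟨ sym (∂-∑< p (λ j v → G l (rotw^ j v) * asc (s (rotw^ j v)) (s (rotw^ j w))) w) ⟩
        ∂ (λ v → ∑< p (λ j → G l (rotw^ j v) * asc (s (rotw^ j v)) (s (rotw^ j w)))) w
          ≡⟨ ∂-cong w (λ v v⋖w → trans
               (∑<-cong p (λ j → cong₂ _*_ (G-rotw^ l j v (⋖-pred v⋖w sz))
                 (cong₂ asc (s-rotw^ j v (size>0 v (⋖-pred v⋖w sz))) (s-rotw^ j w (size>0 w sz)))))
               (∑<-*ˡ p (G l v) (λ j → asc (rot^ j (s v)) (rot^ j (s w))))) ⟩
        R l w ∎

      -- Insert `D-formula`: the term with `p` vanishes modulo p and the term with `ψ (s w)`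
      -- vanishes because `G l` is a cocycle. Thus `R` is a coboundary modulo p, but of a cochain
      -- that is not invariant.
      R-ψ : ∀ l w → size w ≡ suc (suc (l ℕ.* 2)) → R l w ≈ ∂ (λ v → G l v * ψ (s v)) w
      R-ψ l w sz = ∂ (λ v → G l v * asc (s v) (s w)) w by (begin
        R l w
          ≡⟨ ∂-cong w (λ v _ → trans (cong (G l v *_) (D-formula (s v) (s w))) (dist (G l v) (asc (s v) (s w)) (ψ (s v)) (ψ (s w)) (+ p))) ⟩
        ∂ (λ v → G l v * ψ (s v) - G l v * ψ (s w) + G l v * asc (s v) (s w) * + p) w
          ≡⟨ trans (∂-+ _ _ w) (cong₂ _+_ (∂-sub _ _ w) (∂-*ʳ _ (+ p) w)) ⟩
        ∂ (λ v → G l v * ψ (s v)) w - ∂ (λ v → G l v * ψ (s w)) w + Q (G l) w * + p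
          ≡⟨ cong (λ z → ∂ (λ v → G l v * ψ (s v)) w - z + Q (G l) w * + p)
                (trans (∂-*ʳ (G l) (ψ (s w)) w) (trans (cong (_* ψ (s w)) (∂-G l w sz)) (ℤ.*-zeroˡ (ψ (s w))))) ⟩
        ∂ (λ v → G l v * ψ (s v)) w - 0ℤ + Q (G l) w * + p
          ≡⟨ cong (_+ Q (G l) w * + p) (ℤ.+-identityʳ (∂ (λ v → G l v * ψ (s v)) w)) ⟩
        ∂ (λ v → G l v * ψ (s v)) w + Q (G l) w * + p ∎)
        where
        dist : ∀ g a x y P → g * (P * a + (x - y)) ≡ g * x - g * y + g * a * P
        dist = solve-∀

      -- Rotation fixes `G l` and adds 1 to ψ modulo p.
      τ-ψ : ∀ l w → size w ≡ suc (l ℕ.* 2) →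
            G l (rotw w) * ψ (s (rotw w)) - G l w * ψ (s w) ≈ G l w
      τ-ψ l w sz = (- (G l w * wrap (s w))) by (begin
        G l (rotw w) * ψ (s (rotw w)) - G l w * ψ (s w)
          ≡⟨ cong (_- G l w * ψ (s w)) (cong₂ _*_ (G-rotw l w sz) (trans (cong ψ (equi w (size>0 w sz))) (ψ-rot (s w)))) ⟩
        G l w * (ψ (s w) + 1ℤ - + p * wrap (s w)) - G l w * ψ (s w)
          ≡⟨ lem (G l w) (ψ (s w)) (+ p) (wrap (s w)) ⟩
        G l w + (- (G l w * wrap (s w))) * + p ∎)
        where
        lem : ∀ g x P u → g * (x + 1ℤ - P * u) - g * x ≡ g + (- (g * u)) * P
        lem = solve-∀

  G-nothing : ∀ {n} (s : Word (suc n) → Fin p) l w → G s l (nothing ∷ w) ≡ G (s ∘ (nothing ∷_)) l w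
  G-nothing s zero    w = refl
  G-nothing s (suc l) w = ∂-cong w λ v _ → ∂-cong v λ u _ → cong (_* asc (s (nothing ∷ u)) (s (nothing ∷ v))) (G-nothing s l u)

  R-nothing : ∀ {n} (s : Word (suc n) → Fin p) l w →
              ∂ (λ v → G s l (nothing ∷ v) * D (s (nothing ∷ v)) (s (nothing ∷ w))) w ≡ R (s ∘ (nothing ∷_)) l w
  R-nothing s l w = ∂-cong w λ u _ → cong (_* D (s (nothing ∷ u)) (s (nothing ∷ w))) (G-nothing s l u)

  even?-2 : ∀ l → even? (l ℕ.* 2) ≡ true
  even?-2 zero    = refl
  even?-2 (suc l) = cong (not ∘ not) (even?-2 l)

  op-odd : ∀ {m} l → m ≡ suc (l ℕ.* 2) → ∀ {n} (F : Word n → ℤ) w → op m F w ≡ F (rotw w) - F w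
  op-odd l refl F w = cong (λ b → τσ b F w) (even?-2 l)

  op-even : ∀ {m} l → m ≡ suc (suc (l ℕ.* 2)) → ∀ {n} (F : Word n → ℤ) w → op m F w ≡ ∑< p (λ j → F (rotw^ j w))
  op-even l refl F w = cong (λ b → τσ (not b) F w) (even?-2 l)

  -- By `R-ψ` the cochain is a coboundary, so `h-∂` moves the evaluation to the base of the cone.
  -- There rot - 1 is applied to G·ψ, which gives `G` by `τ-ψ`.
  h-R-G : ∀ {m} l → m ≡ suc (l ℕ.* 2) → (s : Word (suc m) → Fin p) → Equivariant s →
          h (suc m) (R s l) ≈ h m (G (s ∘ (nothing ∷_)) l)
  h-R-G {m} l m≡ s equi =
    ≈-trans (h-cong≈ (suc m) {R s l} {∂ F} (λ w sz → R-ψ s equi l w (trans sz (cong suc m≡))))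
   (≈-trans (h-∂ m F)
            (h-cong≈ m {op m (F ∘ (nothing ∷_))} {G (s ∘ (nothing ∷_)) l} λ w sz →
              ≈-trans (≡⇒≈ (op-odd l m≡ (F ∘ (nothing ∷_)) w))
             (≈-trans (τ-ψ s equi l (nothing ∷ w) (trans sz m≡)) (≡⇒≈ (G-nothing s l w)))))
    where
    F : Word (suc m) → ℤ
    F v = G s l v * ψ (s v)

  -- The same descent for the coboundary of `Q`: now the base carries the orbit sum, which `Q-orbit`
  -- identifies with `R`.
  h-G-R : ∀ {m} l → m ≡ suc (suc (l ℕ.* 2)) → (s : Word (suc m) → Fin p) → Equivariant s →
          h (suc m) (G s (suc l)) ≈ h m (R (s ∘ (nothing ∷_)) l)
  h-G-R {m} l m≡ s equi =
    ≈-trans (h-∂ m F)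
            (h-cong≈ m {op m (F ∘ (nothing ∷_))} {R (s ∘ (nothing ∷_)) l} λ w sz → ≡⇒≈ (begin
              op m (F ∘ (nothing ∷_)) w               ≡⟨ op-even l m≡ (F ∘ (nothing ∷_)) w ⟩
              ∑< p (λ j → F (nothing ∷ rotw^ j w))    ≡⟨ ∑<-cong p (λ j → cong F (sym (rotw^-nothing j w))) ⟩
              ∑< p (λ j → F (rotw^ j (nothing ∷ w)))  ≡⟨ Q-orbit s equi l (nothing ∷ w) (trans sz m≡) ⟩
              R s l (nothing ∷ w)                     ≡⟨ R-nothing s l w ⟩
              R (s ∘ (nothing ∷_)) l w                ∎))
    where
    F : Word (suc m) → ℤ
    F = Q s (G s l)

  -- The two descents alternate and end at the constant cochain 1 evaluated at the point h₁.
  h-G : ∀ {m} l → m ≡ suc (l ℕ.* 2) → (s : Word m → Fin p) → Equivariant s → h m (G s l) ≈ 1ℤ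
  h-R : ∀ {m} l → m ≡ suc (l ℕ.* 2) → (s : Word (suc m) → Fin p) → Equivariant s → h (suc m) (R s l) ≈ 1ℤ

  h-R l m≡ s equi = ≈-trans (h-R-G l m≡ s equi) (h-G l m≡ (s ∘ (nothing ∷_)) (λ w → equi (nothing ∷ w)))

  h-G zero              refl s equi = ≡⇒≈ refl
  h-G {suc (suc m)} (suc l) m≡ s equi =
    ≈-trans (h-G-R l (ℕ.suc-injective m≡) s equi)
            (h-R l (ℕ.suc-injective (ℕ.suc-injective m≡)) (s ∘ (nothing ∷_)) (λ w → equi (nothing ∷ w)))

  half : ∀ n → (∃ λ l → n ≡ l ℕ.* 2) ⊎ (∃ λ l → n ≡ suc (l ℕ.* 2))
  half zero    = inj₁ (0 , refl)
  half (suc n) with half n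
  ... | inj₁ (l , eq) = inj₂ (l , cong suc eq)
  ... | inj₂ (l , eq) = inj₁ (suc l , cong suc eq)

  -- According to the parity of the size, `G` or `R` has top degree. Its value at the chain is
  -- nonzero, so it is nonzero at some word of full size.
  tucker : ∀ n (s : Word (suc n) → Fin p) → Equivariant s → ∃ λ w → size w ≡ suc n × Alternating s w
  tucker n s equi = [ (λ (l , n≡) → from (G s l) (h-G l (cong suc n≡) s equi) λ w sz → G-alternating s l w (trans sz (cong suc n≡)))
                    , (λ (l , n≡) → from (R s l) (h-R l n≡ s equi) λ w sz → R-alternating s l w (trans sz (cong suc n≡)))
                    ]′ (half n)
    where
    from : (F : Word (suc n) → ℤ) → h (suc n) F ≈ 1ℤ → (∀ w → size w ≡ suc n → F w ≢ 0ℤ → Alternating s w) →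
           ∃ λ w → size w ≡ suc n × Alternating s w
    from F h≈1 alt = let w , sz , ne = h-nonzero (suc n) F (≈1⇒≢0 h≈1) in w , sz , alt w sz ne

-- Finite sums and counts of natural numbers

open import Data.Nat using (_+_; _*_; _∸_; _≤_; _<_; _/_; _⊓_; _⊔_; z≤n; s≤s; ⌊_/2⌋; ⌈_/2⌉)
open import Algebra.Properties.CommutativeMonoid.Sum ℕ.+-0-commutativeMonoid using (sum; sum-cong-≗; ∑-distrib-+; sum-permute)
open import Algebra.Properties.Semiring.Sum ℕ.+-*-semiring using (*-distribʳ-sum)

sum-mono : ∀ {n} {f g : Fin n → ℕ} → (∀ i → f i ≤ g i) → sum f ≤ sum g
sum-mono {zero}  f≤g = z≤n
sum-mono {suc n} f≤g = ℕ.+-mono-≤ (f≤g zero) (sum-mono (f≤g ∘ suc))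

-- Turns the stationarity of a sum of monotone quantities into that of each summand.
sum-≤⇒≗ : ∀ {n} {f g : Fin n → ℕ} → (∀ i → f i ≤ g i) → sum g ≤ sum f → ∀ i → f i ≡ g i
sum-≤⇒≗ {suc n} {f} {g} f≤g Σg≤Σf = λ
  { zero    → ℕ.≤-antisym (f≤g zero) (ℕ.+-cancelʳ-≤ (sum (g ∘ suc)) (g zero) (f zero)
                 (ℕ.≤-trans Σg≤Σf (ℕ.+-monoʳ-≤ (f zero) (sum-mono (f≤g ∘ suc)))))
  ; (suc i) → sum-≤⇒≗ (f≤g ∘ suc) (ℕ.+-cancelˡ-≤ (g zero) _ _
                 (ℕ.≤-trans Σg≤Σf (ℕ.+-monoˡ-≤ (sum (f ∘ suc)) (f≤g zero)))) i }

sum-const : ∀ n x → sum {n} (λ _ → x) ≡ n * x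
sum-const zero    x = refl
sum-const (suc n) x = cong (x +_) (sum-const n x)

sum-bound : ∀ {n} {f : Fin n → ℕ} {x} → (∀ i → f i ≤ x) → sum f ≤ n * x
sum-bound {n} {x = x} f≤x = ℕ.≤-trans (sum-mono f≤x) (ℕ.≤-reflexive (sum-const n x))

sum≡0 : ∀ {n} {f : Fin n → ℕ} → sum f ≡ 0 → ∀ i → f i ≡ 0
sum≡0 {n} {f} Σf≡0 i = sym (sum-≤⇒≗ {f = λ _ → 0} {f} (λ _ → z≤n) (ℕ.≤-trans (ℕ.≤-reflexive Σf≡0) z≤n) i)

𝟙 : Bool → ℕ
𝟙 true  = 1
𝟙 false = 0

𝟙≤1 : ∀ b → 𝟙 b ≤ 1
𝟙≤1 true  = ℕ.≤-refl
𝟙≤1 false = z≤n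

𝟙-injective : ∀ {a b} → 𝟙 a ≡ 𝟙 b → a ≡ b
𝟙-injective {true}  {true}  _ = refl
𝟙-injective {false} {false} _ = refl

𝟙-mono : ∀ {P Q : Set} (P? : Dec P) (Q? : Dec Q) → (P → Q) → 𝟙 (does P?) ≤ 𝟙 (does Q?)
𝟙-mono (no _)  _       _ = z≤n
𝟙-mono (yes p) (yes _) _ = ℕ.≤-refl
𝟙-mono (yes p) (no ¬q) f = contradiction (f p) ¬q

does-true : ∀ {P : Set} (P? : Dec P) → does P? ≡ true → P
does-true (yes p) _ = p

does-false : ∀ {P : Set} (P? : Dec P) → does P? ≡ false → ¬ P
does-false (no ¬p) _ = ¬p

#_ : ∀ {n} → (Fin n → Bool) → ℕ
# S = sum (𝟙 ∘ S)

#≤n : ∀ {n} (S : Fin n → Bool) → # S ≤ n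
#≤n {n} S = ℕ.≤-trans (sum-bound (𝟙≤1 ∘ S)) (ℕ.≤-reflexive (ℕ.*-identityʳ n))

#≡n⇒true : ∀ {n} (S : Fin n → Bool) → # S ≡ n → ∀ i → S i ≡ true
#≡n⇒true {n} S eq i = 𝟙-injective (sum-≤⇒≗ {f = 𝟙 ∘ S} {λ _ → 1} (𝟙≤1 ∘ S) (ℕ.≤-reflexive (trans (sum-const n 1) (trans (ℕ.*-identityʳ n) (sym eq)))) i)

#≡0⇒false : ∀ {n} (S : Fin n → Bool) → # S ≡ 0 → ∀ i → S i ≡ false
#≡0⇒false S eq i = 𝟙-injective (sum≡0 {f = 𝟙 ∘ S} eq i)

-- For n = p these are the subsets invariant under rotation, from which no point can be chosen
-- equivariantly.
Trivial : ∀ {n} → (Fin n → Bool) → Set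
Trivial {n} S = # S ≡ 0 ⊎ # S ≡ n

trivial? : ∀ {n} (S : Fin n → Bool) → Trivial S ⊎ (0 < # S × # S < n)
trivial? {n} S with # S ℕ.≟ 0 | # S ℕ.≟ n
... | yes #≡0 | _       = inj₁ (inj₁ #≡0)
... | no _    | yes #≡n = inj₁ (inj₂ #≡n)
... | no #≢0  | no #≢n  = inj₂ (ℕ.n≢0⇒n>0 #≢0 , ℕ.≤∧≢⇒< (#≤n S) #≢n)

nontrivial : ∀ {n} {S T : Fin n → Bool} → # S ≡ # T → 0 < # S → # S < n → ¬ Trivial T
nontrivial eq 0< <n (inj₁ #≡0) = ℕ.<⇒≢ 0< (sym (trans eq #≡0))
nontrivial eq 0< <n (inj₂ #≡n) = ℕ.<⇒≢ <n (trans eq #≡n)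

-- Equivariant choice of a point of ℤ/p from a list of subsets

module Representative {p : ℕ} (prime : Prime p) .{{_ : NonZero p}} where

  open ≡-Reasoning
  open Rotation p

  -- The inverse of d modulo p. The existential stands before the bounds on d so that the witness
  -- depends on d alone and `rep` is defined for all subsets. The natural numbers i and j express
  -- the congruence without subtraction.
  inverse : ∀ d → ∃ λ v → 0 < d → d < p → ∃ λ i → ∃ λ j → v * d + i * p ≡ 1 + j * p
  inverse d with 0 ℕ.<? d | d ℕ.<? p
  ... | no ¬0<d | _       = 0 , λ 0<d → contradiction 0<d ¬0<d
  ... | yes _   | no d≮p  = 0 , λ _ d<p → contradiction d<p d≮p
  ... | yes 0<d | yes d<p with coprime-Bézout (prime⇒coprime prime {{ℕ.>-nonZero 0<d}} d<p)
  ...   | Bézout.-+ x y eq = y , λ _ _ → 0 , x , trans (ℕ.+-identityʳ (y * d)) (sym eq)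
  -- Here -y is the inverse, and p - 1 times y represents it by a natural number.
  ...   | Bézout.+- x y eq = ℕ.pred p * y , λ _ _ → 1 , ℕ.pred p * x , (begin
    ℕ.pred p * y * d + 1 * p               ≡⟨ cong (λ z → ℕ.pred p * y * d + 1 * z) (sym (ℕ.suc-pred p)) ⟩
    ℕ.pred p * y * d + 1 * suc (ℕ.pred p)  ≡⟨ lem (ℕ.pred p) y d ⟩
    1 + ℕ.pred p * (1 + y * d)             ≡⟨ cong (λ z → 1 + ℕ.pred p * z) eq ⟩
    1 + ℕ.pred p * (x * p)                   ≡⟨ cong (1 +_) (sym (ℕ.*-assoc (ℕ.pred p) x p)) ⟩
    1 + ℕ.pred p * x * p                     ∎)
    where
    lem : ∀ q y d → q * y * d + 1 * suc q ≡ 1 + q * (1 + y * d)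
    lem = ℕSolver.solve-∀

  mod-cong : ∀ {x y} i j → x + i * p ≡ y + j * p → x mod p ≡ y mod p
  mod-cong {x} {y} i j eq = Fin.toℕ-injective (begin
    toℕ (x mod p)          ≡⟨ toℕ-mod x ⟩
    x % p                  ≡⟨ sym ([m+kn]%n≡m%n x i p) ⟩
    (x + i * p) % p    ≡⟨ cong (_% p) eq ⟩
    (y + j * p) % p    ≡⟨ [m+kn]%n≡m%n y j p ⟩
    y % p                  ≡⟨ sym (toℕ-mod y) ⟩
    toℕ (y mod p)          ∎)

  sum-rot : ∀ (f : Fin p → ℕ) → sum f ≡ sum (f ∘ rot)
  sum-rot f = sum-permute f (permutation rot (rot^ (ℕ.pred p)) rot-rot⁻¹ rot^-pred-rot)
    where
    rot-rot⁻¹ : ∀ a → rot (rot^ (ℕ.pred p) a) ≡ a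
    rot-rot⁻¹ a = trans (cong (λ k → rot^ k a) (ℕ.suc-pred p)) (rot^-p a)

  moment : (Fin p → Bool) → ℕ
  moment S = sum λ i → 𝟙 (S i) * toℕ i

  -- The barycentre of S in ℤ/p; here primality is used.
  rep : (Fin p → Bool) → Fin p
  rep S = (proj₁ (inverse (# S)) * moment S) mod p

  rep-cong : ∀ {S T : Fin p → Bool} → S ≗ T → rep S ≡ rep T
  rep-cong {S} {T} S≗T = cong₂ (λ d x → (proj₁ (inverse d) * x) mod p)
    (sum-cong-≗ (cong 𝟙 ∘ S≗T)) (sum-cong-≗ λ i → cong (λ b → 𝟙 b * toℕ i) (S≗T i))

  -- Rotation adds the size of S to the moment modulo p; multiplied by the inverse of that size,
  -- this is a shift by 1.
  rep-rot : ∀ {S T : Fin p → Bool} → (∀ i → T (rot i) ≡ S i) → 0 < # S → # S < p → rep T ≡ rot (rep S)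
  rep-rot {S} {T} T∘rot≗S 0<#S #S<p with proj₂ (inverse (# S)) 0<#S #S<p
  ... | i , j , eq = begin
    (proj₁ (inverse (# T)) * moment T) mod p ≡⟨ cong (λ d → (proj₁ (inverse d) * moment T) mod p) #T≡#S ⟩
    (v * moment T) mod p                     ≡⟨ mod-cong (v * K + i) j main ⟩
    suc (v * moment S) mod p                 ≡⟨ sym (rot-mod (v * moment S)) ⟩
    rot (rep S)                                ∎
    where
    v = proj₁ (inverse (# S))
    #T≡#S : # T ≡ # S
    #T≡#S = trans (sum-rot (𝟙 ∘ T)) (sum-cong-≗ (cong 𝟙 ∘ T∘rot≗S))
    -- Records the wrap-around of p - 1 to 0, which lowers the moment by p.
    K : ℕ
    K = sum λ a → 𝟙 (S a) * (suc (toℕ a) / p)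
    shift : moment T + K * p ≡ # S + moment S
    shift = begin
      moment T + K * p
        ≡⟨ cong₂ _+_ (trans (sum-rot _) (sum-cong-≗ λ a → cong₂ _*_ (cong 𝟙 (T∘rot≗S a)) (toℕ-mod (suc (toℕ a)))))
                        (*-distribʳ-sum p λ a → 𝟙 (S a) * (suc (toℕ a) / p)) ⟩
      sum (λ a → 𝟙 (S a) * (suc (toℕ a) % p)) + sum (λ a → 𝟙 (S a) * (suc (toℕ a) / p) * p)
        ≡⟨ sym (∑-distrib-+ (λ a → 𝟙 (S a) * (suc (toℕ a) % p)) (λ a → 𝟙 (S a) * (suc (toℕ a) / p) * p)) ⟩
      sum (λ a → 𝟙 (S a) * (suc (toℕ a) % p) + 𝟙 (S a) * (suc (toℕ a) / p) * p)
        ≡⟨ sum-cong-≗ (λ a → trans (lem (𝟙 (S a)) (suc (toℕ a) % p) (suc (toℕ a) / p) p)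
                            (trans (cong (𝟙 (S a) *_) (sym (m≡m%n+[m/n]*n (suc (toℕ a)) p))) (ℕ.*-suc (𝟙 (S a)) (toℕ a)))) ⟩
      sum (λ a → 𝟙 (S a) + 𝟙 (S a) * toℕ a)
        ≡⟨ ∑-distrib-+ (𝟙 ∘ S) (λ a → 𝟙 (S a) * toℕ a) ⟩
      # S + moment S ∎
      where
      lem : ∀ b x y p → b * x + b * y * p ≡ b * (x + y * p)
      lem = ℕSolver.solve-∀
    main : v * moment T + (v * K + i) * p ≡ suc (v * moment S) + j * p
    main = begin
      v * moment T + (v * K + i) * p           ≡⟨ lem₁ v (moment T) K i p ⟩
      v * (moment T + K * p) + i * p           ≡⟨ cong (λ x → v * x + i * p) shift ⟩
      v * (# S + moment S) + i * p               ≡⟨ lem₂ v (# S) (moment S) (i * p) ⟩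
      v * # S + i * p + v * moment S           ≡⟨ cong (_+ v * moment S) eq ⟩
      1 + j * p + v * moment S                   ≡⟨ cong suc (ℕ.+-comm (j * p) (v * moment S)) ⟩
      suc (v * moment S) + j * p                   ∎
      where
      lem₁ : ∀ v m k i p → v * m + (v * k + i) * p ≡ v * (m + k * p) + i * p
      lem₁ = ℕSolver.solve-∀
      lem₂ : ∀ v d m x → v * (d + m) + x ≡ v * d + x + v * m
      lem₂ = ℕSolver.solve-∀

  pick : ℕ → (ℕ → Fin p → Bool) → Fin p → Fin p
  pick zero    L d = d
  pick (suc k) L d with trivial? (L k)
  ... | inj₁ _ = pick k L d
  ... | inj₂ _ = rep (L k)

  -- Rotation preserves the sizes of the sets, so both searches stop at the same index.
  pick-rot : ∀ k {L L′} {d d′} → (∀ j i → L′ j (rot i) ≡ L j i) → d′ ≡ rot d → pick k L′ d′ ≡ rot (pick k L d)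
  pick-rot zero    eq d≡ = d≡
  pick-rot (suc k) {L} {L′} eq d≡ with trivial? (L k) | trivial? (L′ k) | trans (sum-rot (𝟙 ∘ L′ k)) (sum-cong-≗ (cong 𝟙 ∘ eq k))
  ... | inj₁ _         | inj₁ _         | _  = pick-rot k eq d≡
  ... | inj₂ (0< , <p) | inj₂ _         | _  = rep-rot (eq k) 0< <p
  ... | inj₁ triv      | inj₂ (0< , <p) | #≡ = contradiction triv (nontrivial #≡ 0< <p)
  ... | inj₂ (0< , <p) | inj₁ triv      | #≡ = contradiction triv (nontrivial (sym #≡) 0< <p)

  -- Agreement at j is demanded under the assumption that all higher sets are trivial, since
  -- otherwise the choice is made before j is reached. The defaults are unrelated, hence the second
  -- alternative.
  pick-cong : ∀ k {L L′} {d d′} →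
              (∀ j → j < k → (∀ i → j < i → i < k → Trivial (L i)) → L j ≗ L′ j) →
              pick k L d ≡ pick k L′ d′ ⊎ (∀ j → j < k → Trivial (L j))
  pick-cong zero    eq = inj₂ λ _ ()
  pick-cong (suc k) {L} {L′} {d} {d′} eq
    with trivial? (L k) | trivial? (L′ k) | eq k ℕ.≤-refl (λ i k<i i≤k → contradiction i≤k (ℕ.<⇒≱ (s≤s k<i)))
  ... | inj₂ _         | inj₂ _         | eqₖ = inj₁ (rep-cong eqₖ)
  ... | inj₁ triv      | inj₂ (0< , <p) | eqₖ = contradiction triv (nontrivial (sum-cong-≗ (sym ∘ cong 𝟙 ∘ eqₖ)) 0< <p)
  ... | inj₂ (0< , <p) | inj₁ triv      | eqₖ = contradiction triv (nontrivial (sum-cong-≗ (cong 𝟙 ∘ eqₖ)) 0< <p)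
  ... | inj₁ triv      | inj₁ _         | _   = [ inj₁ , (λ all → inj₂ λ j j≤k → below (all j) (ℕ.m≤n⇒m<n∨m≡n (ℕ.≤-pred j≤k))) ]′
      (pick-cong k λ j j<k higher → eq j (ℕ.m<n⇒m<1+n j<k) λ i j<i i≤k →
        below (higher i j<i) (ℕ.m≤n⇒m<n∨m≡n (ℕ.≤-pred i≤k)))
    where
    below : ∀ {i} → (i < k → Trivial (L i)) → i < k ⊎ i ≡ k → Trivial (L i)
    below lower (inj₁ i<k)  = lower i<k
    below lower (inj₂ refl) = triv

open ℕ.≤-Reasoning

-- Subsets and admissible sets

interpolate : ∀ {n} {A C : Subset n} k → A ⊆ C → ∣ A ∣ ≤ k → k ≤ ∣ C ∣ → ∃ λ F → A ⊆ F × F ⊆ C × ∣ F ∣ ≡ k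
interpolate {A = []}          {[]}          zero A⊆C _ _ = [] , id , id , refl
interpolate {A = outside ∷ A} {outside ∷ C} k A⊆C A≤k k≤C
  with interpolate k (Subset.drop-∷-⊆ A⊆C) A≤k k≤C
... | F , A⊆F , F⊆C , eq = outside ∷ F , Subset.s⊆s A⊆F , Subset.s⊆s F⊆C , eq
interpolate {A = inside ∷ A}  {outside ∷ C} k A⊆C _ _ with () ← A⊆C here
interpolate {A = inside ∷ A}  {inside ∷ C} (suc k) A⊆C (s≤s A≤k) (s≤s k≤C)
  with interpolate k (Subset.drop-∷-⊆ A⊆C) A≤k k≤C
... | F , A⊆F , F⊆C , eq = inside ∷ F , Subset.s⊆s A⊆F , Subset.s⊆s F⊆C , cong suc eq
interpolate {A = outside ∷ A} {inside ∷ C} k A⊆C A≤k k≤C with k ℕ.≤? ∣ C ∣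
-- The tail cannot supply k elements, so k is the size of the whole upper set.
... | no k≰C = inside ∷ C , Subset.out⊆ (Subset.drop-∷-⊆ A⊆C) , id , ℕ.≤-antisym (ℕ.≰⇒> k≰C) k≤C
... | yes k≤C′ with interpolate k (Subset.drop-∷-⊆ A⊆C) A≤k k≤C′
...   | F , A⊆F , F⊆C , eq = outside ∷ F , Subset.s⊆s A⊆F , Subset.out⊆ F⊆C , eq

∣∷∣ : ∀ {n} b (A : Subset n) → ∣ b ∷ A ∣ ≡ 𝟙 b + ∣ A ∣
∣∷∣ inside  A = refl
∣∷∣ outside A = refl

∣∩∣+∣─∣ : ∀ {n} (A B : Subset n) → ∣ A ∩ B ∣ + ∣ A ─ B ∣ ≡ ∣ A ∣
∣∩∣+∣─∣ []            []            = refl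
∣∩∣+∣─∣ (outside ∷ A) (inside  ∷ B) = ∣∩∣+∣─∣ A B
∣∩∣+∣─∣ (outside ∷ A) (outside ∷ B) = ∣∩∣+∣─∣ A B
∣∩∣+∣─∣ (inside  ∷ A) (inside  ∷ B) = cong suc (∣∩∣+∣─∣ A B)
∣∩∣+∣─∣ (inside  ∷ A) (outside ∷ B) = trans (ℕ.+-suc ∣ A ∩ B ∣ ∣ A ─ B ∣) (cong suc (∣∩∣+∣─∣ A B))

─⇒∉ : ∀ {n} (A B : Subset n) {x} → x ∈ A ─ B → x ∉ B
─⇒∉ (inside ∷ A)  (outside ∷ B) here       ()
─⇒∉ (a ∷ A)       (outside ∷ B) (there x∈) (there x∈B) = ─⇒∉ A B x∈ x∈B
─⇒∉ (a ∷ A)       (inside ∷ B)  (there x∈) (there x∈B) = ─⇒∉ A B x∈ x∈B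

─-monoˡ : ∀ {n} {A C : Subset n} (B : Subset n) → A ⊆ C → A ─ B ⊆ C ─ B
─-monoˡ {A = A} B A⊆C x∈ = Subset.x∈p∧x∉q⇒x∈p─q (A⊆C (Subset.p─q⊆p A B x∈)) (─⇒∉ A B x∈)

∣─∣-mono : ∀ {n} {A C : Subset n} (B : Subset n) → A ⊆ C → ∣ A ─ B ∣ ≤ ∣ C ─ B ∣
∣─∣-mono B A⊆C = Subset.p⊆q⇒∣p∣≤∣q∣ (─-monoˡ B A⊆C)

Admissible : ∀ {n} → Subset n → ℕ → ℕ → Subset n → Set
Admissible B q t F = ∣ F ∣ ≡ suc q × t < ∣ F ─ B ∣

admissible? : ∀ {n} (B : Subset n) q t F → Dec (Admissible B q t F)
admissible? B q t F = (∣ F ∣ ℕ.≟ suc q) ×-dec (t ℕ.<? ∣ F ─ B ∣)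

-- First secure t + 1 elements outside B, which fit into a set of size q + 1 because t ≤ q; then
-- fill up inside A.
admissible-within : ∀ {n q t} (A B : Subset n) → t ≤ q → q < ∣ A ∣ → t < ∣ A ─ B ∣ → ∃ λ F → F ⊆ A × Admissible B q t F
admissible-within {n} {q} {t} A B t≤q q<A t<A─B
  with interpolate {A = ⊥} {A ─ B} (suc t) Subset.⊥⊆ (ℕ.≤-trans (ℕ.≤-reflexive (Subset.∣⊥∣≡0 n)) z≤n) t<A─B
... | F₀ , _ , F₀⊆A─B , F₀≡
  with interpolate {A = F₀} {A} (suc q) (Subset.p─q⊆p A B ∘ F₀⊆A─B) (ℕ.≤-trans (ℕ.≤-reflexive F₀≡) (s≤s t≤q)) q<A
...   | F , F₀⊆F , F⊆A , F≡ = F , F⊆A , F≡ , (begin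
  suc t     ≡⟨ sym F₀≡ ⟩
  ∣ F₀ ∣    ≤⟨ Subset.p⊆q⇒∣p∣≤∣q∣ (λ x∈ → Subset.x∈p∧x∉q⇒x∈p─q (F₀⊆F x∈) (─⇒∉ A B (F₀⊆A─B x∈))) ⟩
  ∣ F ─ B ∣ ∎)

record MonochromaticEdge {n} (B : Subset n) (q t : ℕ) (c : Subset n → ℕ) (r : ℕ) : Set where
  field
    sets          : Fin r → Subset n
    admissible    : ∀ i → Admissible B q t (sets i)
    disjoint      : ∀ {i j} → i ≢ j → ∀ {x} → x ∈ sets i → x ∉ sets j
    colour        : ℕ
    monochromatic : ∀ i → c (sets i) ≡ colour

-- The colouring is total with values in ℕ, and bounded on admissible sets, so that derived
-- colourings may take a default value elsewhere.
Kneser : ℕ → Set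
Kneser r = ∀ {n} m q t (B : Subset n) (c : Subset n → ℕ) → t ≤ q → ∣ B ∣ ≤ r * (q ∸ t) →
           (r ∸ 1) * m + r * q < n → (∀ F → Admissible B q t F → c F < m) →
           MonochromaticEdge B q t c r

-- Words as families of disjoint sets

module Classes {p : ℕ} where

  open Word {Fin p} public

  letter : Maybe (Fin p) → Fin p → Bool
  letter nothing  i = outside
  letter (just x) i = does (i Fin.≟ x)

  class : ∀ {n} → Fin p → Word n → Subset n
  class i []      = []
  class i (x ∷ w) = letter x i ∷ class i w

  class-disjoint : ∀ {n} (w : Word n) {i j} → i ≢ j → ∀ {x} → x ∈ class i w → x ∉ class j w
  class-disjoint (a ∷ w) i≢j (there x∈i) (there x∈j) = class-disjoint w i≢j x∈i x∈j
  class-disjoint (just a ∷ w) {i} {j} i≢j {zero} x∈i x∈j with i Fin.≟ a | j Fin.≟ a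
  ... | yes refl | yes refl = i≢j refl
  ... | no _     | _        with () ← x∈i
  class-disjoint (just a ∷ w) {i} {j} i≢j {zero} x∈i x∈j | yes _ | no _ with () ← x∈j

  ⋖-class : ∀ {n} {v w : Word n} → v ⋖ w → ∀ i → class i v ≡ class i w ⊎ ∣ class i w ∣ ≡ suc ∣ class i v ∣
  ⋖-class (here {x = x}) i with i Fin.≟ x
  ... | yes _ = inj₂ refl
  ... | no _  = inj₁ refl
  ⋖-class (there {y = y} v⋖w) i with letter y i | ⋖-class v⋖w i
  ... | b       | inj₁ eq = inj₁ (cong (b ∷_) eq)
  ... | inside  | inj₂ eq = inj₂ (cong suc eq)
  ... | outside | inj₂ eq = inj₂ eq

  ⋖-letter : ∀ {n} {v w : Word n} → v ⋖ w → ∃ λ i → ∣ class i w ∣ ≡ suc ∣ class i v ∣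
  ⋖-letter (here {x = x} {w})             = x , cong (λ b → ∣ b ∷ class x w ∣) (dec-true (x Fin.≟ x) refl)
  ⋖-letter (there {y = y} {v} {w} v⋖w) with ⋖-letter v⋖w
  ... | i , eq = i , (begin-equality
    ∣ letter y i ∷ class i w ∣             ≡⟨ ∣∷∣ (letter y i) (class i w) ⟩
    𝟙 (letter y i) + ∣ class i w ∣       ≡⟨ cong (𝟙 (letter y i) +_) eq ⟩
    𝟙 (letter y i) + suc ∣ class i v ∣   ≡⟨ ℕ.+-suc (𝟙 (letter y i)) ∣ class i v ∣ ⟩
    suc (𝟙 (letter y i) + ∣ class i v ∣) ≡⟨ cong suc (sym (∣∷∣ (letter y i) (class i v))) ⟩
    suc ∣ letter y i ∷ class i v ∣         ∎)

  ⋖-⊆ : ∀ {n} {v w : Word n} → v ⋖ w → ∀ i → class i v ⊆ class i w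
  ⋖-⊆ here i                   = Subset.out⊆ id
  ⋖-⊆ (there v⋖w) i            = Subset.s⊆s (⋖-⊆ v⋖w i)

  size>0⇒class : ∀ {n} (w : Word n) → 0 < size w → ∃ λ i → 0 < ∣ class i w ∣
  size>0⇒class (nothing ∷ w) pos = size>0⇒class w pos
  size>0⇒class (just x ∷ w)  pos = x , subst (λ b → 0 < ∣ b ∷ class x w ∣) (sym (dec-true (x Fin.≟ x) refl)) (s≤s z≤n)

  sum-letter : ∀ {k} (x : Fin k) → sum (λ i → 𝟙 (does (i Fin.≟ x))) ≡ 1
  sum-letter {suc k} zero    = cong suc (trans (sum-cong-≗ {k} λ _ → refl) (trans (sum-const k 0) (ℕ.*-zeroʳ k)))
  sum-letter {suc k} (suc x) = trans (sum-cong-≗ λ i → cong 𝟙 (does-⇔ (mk⇔ Fin.suc-injective (cong suc)) (suc i Fin.≟ suc x) (i Fin.≟ x))) (sum-letter x)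

  sum-class∩≤ : ∀ {n} (w : Word n) (B : Subset n) → sum (λ i → ∣ class i w ∩ B ∣) ≤ ∣ B ∣
  sum-class∩≤ []      []      = ℕ.≤-reflexive (trans (sum-const p 0) (ℕ.*-zeroʳ p))
  sum-class∩≤ (x ∷ w) (outside ∷ B) = ℕ.≤-trans (ℕ.≤-reflexive (sum-cong-≗ λ i → out i)) (sum-class∩≤ w B)
    where
    out : ∀ i → ∣ class i (x ∷ w) ∩ (outside ∷ B) ∣ ≡ ∣ class i w ∩ B ∣
    out i with letter x i
    ... | inside  = refl
    ... | outside = refl
  sum-class∩≤ (nothing ∷ w) (inside ∷ B) = ℕ.m≤n⇒m≤1+n (sum-class∩≤ w B)
  sum-class∩≤ (just x ∷ w) (inside ∷ B) = begin
    sum (λ i → ∣ class i (just x ∷ w) ∩ (inside ∷ B) ∣)                    ≡⟨ sum-cong-≗ (λ i → ins i) ⟩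
    sum (λ i → 𝟙 (does (i Fin.≟ x)) + ∣ class i w ∩ B ∣)               ≡⟨ ∑-distrib-+ (λ i → 𝟙 (does (i Fin.≟ x))) (λ i → ∣ class i w ∩ B ∣) ⟩
    sum (λ i → 𝟙 (does (i Fin.≟ x))) + sum (λ i → ∣ class i w ∩ B ∣)   ≡⟨ cong (_+ sum (λ i → ∣ class i w ∩ B ∣)) (sum-letter x) ⟩
    suc (sum (λ i → ∣ class i w ∩ B ∣))                                    ≤⟨ s≤s (sum-class∩≤ w B) ⟩
    suc ∣ B ∣                                                              ∎
    where
    ins : ∀ i → ∣ class i (just x ∷ w) ∩ (inside ∷ B) ∣ ≡ 𝟙 (does (i Fin.≟ x)) + ∣ class i w ∩ B ∣
    ins i with i Fin.≟ x
    ... | yes _ = refl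
    ... | no _  = refl

-- The case of a prime number of sets

module PrimeCase {p : ℕ} (prime : Prime p) .{{_ : NonZero p}} (1<p : 1 < p)
  {n : ℕ} (m q t : ℕ) (B : Subset n) (c : Subset n → ℕ)
  (t≤q : t ≤ q) (∣B∣≤ : ∣ B ∣ ≤ p * (q ∸ t)) (c<m : ∀ F → Admissible B q t F → c F < m) where

  open Rotation p
  open Classes {p}
  open ZpTucker p 1<p hiding (Q; R; G; h)
  open Representative prime

  Hit : ℕ → Subset n → Set
  Hit j A = ∃ λ F → F ⊆ A × Admissible B q t F × c F ≡ j

  hit? : ∀ j A → Dec (Hit j A)
  hit? j A = Subset.anySubset? λ F → (F Subset.⊆? A) ×-dec admissible? B q t F ×-dec (c F ℕ.≟ j)

  hit-mono : ∀ {j A C} → A ⊆ C → Hit j A → Hit j C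
  hit-mono A⊆C (F , F⊆A , adm , cF≡j) = F , (λ {x} → A⊆C ∘ F⊆A {x}) , adm , cF≡j

  rich⇒hit : ∀ {A} → q < ∣ A ∣ → t < ∣ A ─ B ∣ → ∃ λ (j : Fin m) → Hit (toℕ j) A
  rich⇒hit {A} q<A t<A─B with admissible-within A B t≤q q<A t<A─B
  ... | F , F⊆A , adm = fromℕ< (c<m F adm) , F , (λ {x} → F⊆A {x}) , adm , sym (Fin.toℕ-fromℕ< (c<m F adm))

  -- The numbering matters: pick tries high indices first, and along a step with Φ stationary the sets of index 0
  -- are only known to agree when all the others are trivial.
  family : ℕ → Subset n → Bool
  family 0             A = does (t ℕ.<? ∣ A ─ B ∣)
  family 1             A = does (q ℕ.≤? ∣ A ∣)
  family (suc (suc j)) A = does (hit? j A)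

  types : Word n → ℕ → Fin p → Bool
  types w j i = family j (class i w)

  hits : Word n → Fin m → ℕ
  hits w j = # types w (2 + toℕ j)

  -- An equivariant default for `pick`; the value at the empty word is arbitrary.
  firstLetter : ∀ {n} → Word n → Fin p
  firstLetter []            = origin
  firstLetter (nothing ∷ w) = firstLetter w
  firstLetter (just x ∷ w)  = x

  firstLetter-rotw : ∀ {n} (w : Word n) → 0 < size w → firstLetter (rotw w) ≡ rot (firstLetter w)
  firstLetter-rotw (nothing ∷ w) pos = firstLetter-rotw w pos
  firstLetter-rotw (just x ∷ w)  pos = refl

  sign : Word n → Fin p
  sign w = pick (2 + m) (types w) (firstLetter w)

  rot-injective : ∀ {a b} → rot a ≡ rot b → a ≡ b
  rot-injective {a} {b} eq = trans (sym (rot^-pred-rot a)) (trans (cong (rot^ (ℕ.pred p)) eq) (rot^-pred-rot b))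

  class-rotw : ∀ {n} (w : Word n) i → class (rot i) (rotw w) ≡ class i w
  class-rotw []            i = refl
  class-rotw (nothing ∷ w) i = cong (outside ∷_) (class-rotw w i)
  class-rotw (just x ∷ w)  i = cong₂ _∷_ (does-⇔ (mk⇔ rot-injective (cong rot)) (rot i Fin.≟ rot x) (i Fin.≟ x)) (class-rotw w i)

  sign-equivariant : Equivariant sign
  sign-equivariant w pos = pick-rot (2 + m) (λ j i → cong (family j) (class-rotw w i)) (firstLetter-rotw w pos)

  truncated : Word n → Fin p → ℕ
  truncated w i = ∣ class i w ∣ ⊓ q

  Φ : Word n → ℕ
  Φ w = sum (truncated w) + sum (hits w)

  truncated-mono : ∀ {v w} → v ⋖ w → ∀ i → truncated v i ≤ truncated w i
  truncated-mono v⋖w i = ℕ.⊓-monoˡ-≤ q (Subset.p⊆q⇒∣p∣≤∣q∣ (⋖-⊆ v⋖w i))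

  type-mono : ∀ {v w} → v ⋖ w → ∀ j i → 𝟙 (types v (2 + j) i) ≤ 𝟙 (types w (2 + j) i)
  type-mono v⋖w j i = 𝟙-mono (hit? j _) (hit? j _) (hit-mono (⋖-⊆ v⋖w i))

  hits-mono : ∀ {v w} → v ⋖ w → ∀ j → hits v j ≤ hits w j
  hits-mono v⋖w j = sum-mono (type-mono v⋖w (toℕ j))

  NoEdge : Word n → Set
  NoEdge w = ∀ j → hits w j < p

  module Stationary {v w : Word n} (v⋖w : v ⋖ w) (noEdge : NoEdge w) (Φw≤Φv : Φ w ≤ Φ v) where

    truncated≡ : ∀ i → truncated v i ≡ truncated w i
    truncated≡ = sum-≤⇒≗ (truncated-mono v⋖w) (ℕ.+-cancelʳ-≤ (sum (hits v)) _ _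
      (ℕ.≤-trans (ℕ.+-monoʳ-≤ (sum (truncated w)) (sum-mono (hits-mono v⋖w))) Φw≤Φv))

    hits≡ : ∀ j → hits v j ≡ hits w j
    hits≡ = sum-≤⇒≗ (hits-mono v⋖w) (ℕ.+-cancelˡ-≤ (sum (truncated v)) _ _
      (ℕ.≤-trans (ℕ.+-monoˡ-≤ (sum (hits w)) (sum-mono (truncated-mono v⋖w))) Φw≤Φv))

    types≡ : ∀ (j : Fin m) i → types v (2 + toℕ j) i ≡ types w (2 + toℕ j) i
    types≡ j i = 𝟙-injective (sum-≤⇒≗ (type-mono v⋖w (toℕ j)) (ℕ.≤-reflexive (sym (hits≡ j))) i)

    large⇒ : ∀ {a b} → a ⊓ q ≡ b ⊓ q → q ≤ a → q ≤ b
    large⇒ {a} {b} eq q≤a = ℕ.≤-trans (ℕ.≤-reflexive (trans (sym (ℕ.m≥n⇒m⊓n≡n q≤a)) eq)) (ℕ.m⊓n≤m b q)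

    -- The truncated sizes agree, and min(x, q) decides whether q ≤ x.
    large≡ : types v 1 ≗ types w 1
    large≡ i = does-⇔ (mk⇔ (large⇒ (truncated≡ i)) (large⇒ (sym (truncated≡ i)))) (q ℕ.≤? _) (q ℕ.≤? _)

    same-class : ∀ i → ∣ class i w ∣ ≤ ∣ class i v ∣ → class i v ≡ class i w
    same-class i w≤v with ⋖-class v⋖w i
    ... | inj₁ eq = eq
    ... | inj₂ eq = contradiction w≤v (ℕ.<⇒≱ (ℕ.≤-reflexive (sym eq)))

    some-larger : ¬ (∀ i → ∣ class i w ∣ ≤ ∣ class i v ∣)
    some-larger w≤v with ⋖-letter v⋖w
    ... | i , eq = contradiction (w≤v i) (ℕ.<⇒≱ (ℕ.≤-reflexive (sym eq)))

    module _ (trivial : ∀ i → 0 < i → i < 2 + m → Trivial (types v i)) where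

      -- A trivial set of classes hit by a colour is empty or full, and full would be a
      -- monochromatic edge.
      no-hit : ∀ j i → ¬ Hit (toℕ j) (class i w)
      no-hit j i hit with trivial (2 + toℕ j) (s≤s z≤n) (s≤s (s≤s (Fin.toℕ<n j)))
      ... | inj₂ full = ℕ.<⇒≢ (noEdge j) (trans (sym (hits≡ j)) full)
      ... | inj₁ none = does-false (hit? (toℕ j) (class i w)) (#≡0⇒false (types w (2 + toℕ j)) (trans (sym (hits≡ j)) none) i) hit

      not-rich : ∀ i → t < ∣ class i w ─ B ∣ → ∣ class i w ∣ ≤ q
      not-rich i t<w─B = ℕ.≮⇒≥ λ q<w → let j , hit = rich⇒hit q<w t<w─B in no-hit j i hit

      -- If no class reached q elements, truncation would have no effect and Φ would have grown with
      -- the added letter.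
      all-large : ∀ i → q ≤ ∣ class i v ∣
      all-large with trivial 1 (s≤s z≤n) (s≤s (s≤s z≤n))
      ... | inj₂ full = λ i → does-true (q ℕ.≤? ∣ class i v ∣) (#≡n⇒true (types v 1) full i)
      ... | inj₁ none = contradiction w≤v some-larger
        where
        v<q : ∀ i → ∣ class i v ∣ < q
        v<q i = ℕ.≰⇒> (does-false (q ℕ.≤? ∣ class i v ∣) (#≡0⇒false (types v 1) none i))
        w<q : ∀ i → ∣ class i w ∣ < q
        w<q i = ℕ.≰⇒> λ q≤w → ℕ.<⇒≱ (v<q i) (large⇒ (sym (truncated≡ i)) q≤w)
        w≤v : ∀ i → ∣ class i w ∣ ≤ ∣ class i v ∣
        w≤v i = ℕ.≤-reflexive (trans (sym (ℕ.m≤n⇒m⊓n≡m (ℕ.<⇒≤ (w<q i)))) (trans (sym (truncated≡ i)) (ℕ.m≤n⇒m⊓n≡m (ℕ.<⇒≤ (v<q i)))))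

      -- A class of w with more than t elements outside B has at most q elements, since it contains
      -- no admissible set. The class of v has at least q already, so the step left it unchanged.
      wide≡ : types v 0 ≗ types w 0
      wide≡ i = does-⇔ (mk⇔ (λ t<v → ℕ.≤-trans t<v (∣─∣-mono B (⋖-⊆ v⋖w i)))
                            (λ t<w → subst (λ A → t < ∣ A ─ B ∣) (sym (same-class i (ℕ.≤-trans (not-rich i t<w) (all-large i)))) t<w))
                       (t ℕ.<? _) (t ℕ.<? _)

      -- Otherwise every class has at least q - t elements in B, and one of them has more, contradicting ∣ B ∣ ≤ p (q - t).
      not-all-narrow : ¬ (∀ i → ∣ class i w ─ B ∣ ≤ t)
      not-all-narrow narrow with ⋖-letter v⋖w
      ... | x , eq = ℕ.<⇒≢ (begin
          suc (q ∸ t)       ≡⟨ sym (ℕ.+-∸-assoc 1 t≤q) ⟩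
          suc q ∸ t         ≤⟨ meets x (ℕ.≤-trans (s≤s (all-large x)) (ℕ.≤-reflexive (sym eq))) ⟩
          ∣ class x w ∩ B ∣ ∎)
        (sum-≤⇒≗ {f = λ _ → q ∸ t} {λ i → ∣ class i w ∩ B ∣}
          (λ i → meets i (ℕ.≤-trans (all-large i) (Subset.p⊆q⇒∣p∣≤∣q∣ (⋖-⊆ v⋖w i))))
          (ℕ.≤-trans (sum-class∩≤ w B) (ℕ.≤-trans ∣B∣≤ (ℕ.≤-reflexive (sym (sum-const p (q ∸ t)))))) x)
        where
        meets : ∀ i {k} → k ≤ ∣ class i w ∣ → k ∸ t ≤ ∣ class i w ∩ B ∣
        meets i {k} k≤ = ℕ.m≤n+o⇒m∸n≤o k t (begin
          k                                         ≤⟨ k≤ ⟩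
          ∣ class i w ∣                             ≡⟨ sym (∣∩∣+∣─∣ (class i w) B) ⟩
          ∣ class i w ∩ B ∣ + ∣ class i w ─ B ∣   ≤⟨ ℕ.+-monoʳ-≤ ∣ class i w ∩ B ∣ (narrow i) ⟩
          ∣ class i w ∩ B ∣ + t                   ≡⟨ ℕ.+-comm ∣ class i w ∩ B ∣ t ⟩
          t + ∣ class i w ∩ B ∣                   ∎)

    -- If all sets were trivial, either no class of w has more than t elements outside B, against
    -- the bound on ∣ B ∣, or all have; then none exceeds q elements, and none can have grown.
    some-nontrivial : ¬ (∀ j → j < 2 + m → Trivial (types v j))
    some-nontrivial trivial with trivial 0 (s≤s z≤n)
    ... | inj₁ none = not-all-narrow (λ i _ → trivial i) λ i →
      ℕ.≮⇒≥ (does-false (t ℕ.<? ∣ class i w ─ B ∣) (trans (sym (wide≡ (λ i _ → trivial i) i)) (#≡0⇒false (types v 0) none i)))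
    ... | inj₂ full = some-larger λ i → ℕ.≤-trans
      (not-rich (λ i _ → trivial i) i (does-true (t ℕ.<? ∣ class i w ─ B ∣) (trans (sym (wide≡ (λ i _ → trivial i) i)) (#≡n⇒true (types v 0) full i))))
      (all-large (λ i _ → trivial i) i)

    sign≡ : sign v ≡ sign w
    sign≡ = [ id , (λ trivial → contradiction trivial some-nontrivial) ]′ (pick-cong (2 + m) agree)
      where
      agree : ∀ j → j < 2 + m → (∀ i → j < i → i < 2 + m → Trivial (types v i)) → types v j ≗ types w j
      agree 0             _                       higher = wide≡ higher
      agree 1             _                       _      = large≡
      agree (suc (suc j)) (s≤s (s≤s j<m)) _      i =
        subst (λ j → types v (2 + j) i ≡ types w (2 + j) i) (Fin.toℕ-fromℕ< j<m) (types≡ (fromℕ< j<m) i)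

  -- A nonempty class contributes to the truncated sum unless q = 0. In that case t = 0 and B is
  -- empty, so the class contains an admissible set and some colour is hit.
  Φ>0 : ∀ w → 0 < size w → 0 < Φ w
  Φ>0 w pos = ℕ.n≢0⇒n>0 λ Φ≡0 →
    let i , 0<Aᵢ = size>0⇒class w pos
        A = class i w
        q≡0 : q ≡ 0
        q≡0 = [ (λ A≤q → contradiction (trans (sym (ℕ.m≤n⇒m⊓n≡m A≤q)) (truncated≡0 Φ≡0 i)) (ℕ.>⇒≢ 0<Aᵢ))
              , (λ q≤A → trans (sym (ℕ.m≥n⇒m⊓n≡n q≤A)) (truncated≡0 Φ≡0 i)) ]′ (ℕ.≤-total ∣ A ∣ q)
        ∣B∣≡0 = ℕ.n≤0⇒n≡0 (ℕ.≤-trans ∣B∣≤ (ℕ.≤-reflexive (trans (cong (p *_) (trans (cong (_∸ t) q≡0) (ℕ.0∸n≡0 t))) (ℕ.*-zeroʳ p))))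
        A∩B≤0 = ℕ.≤-trans (Subset.∣p∩q∣≤∣q∣ A B) (ℕ.≤-reflexive ∣B∣≡0)
        A≡A─B : ∣ A ─ B ∣ ≡ ∣ A ∣
        A≡A─B = trans (cong (_+ ∣ A ─ B ∣) (sym (ℕ.n≤0⇒n≡0 A∩B≤0))) (∣∩∣+∣─∣ A B)
        j , hit = rich⇒hit (subst (_< ∣ A ∣) (sym q≡0) 0<Aᵢ)
                           (ℕ.≤-trans (s≤s (ℕ.≤-trans t≤q (ℕ.≤-reflexive q≡0))) (subst (0 <_) (sym A≡A─B) 0<Aᵢ))
        missed : types w (2 + toℕ j) i ≡ false
        missed = #≡0⇒false (types w (2 + toℕ j)) (sum≡0 (ℕ.m+n≡0⇒n≡0 (sum (truncated w)) Φ≡0) j) i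
    in does-false (hit? (toℕ j) A) missed hit
    where
    truncated≡0 : Φ w ≡ 0 → ∀ i → truncated w i ≡ 0
    truncated≡0 Φ≡0 = sum≡0 (ℕ.m+n≡0⇒m≡0 (sum (truncated w)) Φ≡0)

  -- A change of sign excludes a stationary step, so Φ grows by at least 1 with each letter.
  size≤Φ : ∀ {w} → Alternating sign w → NoEdge w → size w ≤ Φ w
  size≤Φ {w} (single size≡1) noEdge = ℕ.≤-trans (ℕ.≤-reflexive size≡1) (Φ>0 w (ℕ.≤-reflexive (sym size≡1)))
  size≤Φ {w} (extend {v} alt v⋖w sv≢sw) noEdge = begin
    size w       ≡⟨ ⋖-size v⋖w ⟩
    suc (size v) ≤⟨ s≤s (size≤Φ alt λ j → ℕ.≤-<-trans (hits-mono v⋖w j) (noEdge j)) ⟩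
    suc (Φ v)    ≤⟨ ℕ.≰⇒> (λ Φw≤Φv → sv≢sw (Stationary.sign≡ v⋖w noEdge Φw≤Φv)) ⟩
    Φ w          ∎

  Φ≤ : ∀ w → NoEdge w → Φ w ≤ (p ∸ 1) * m + p * q
  Φ≤ w noEdge = begin
    sum (truncated w) + sum (hits w) ≤⟨ ℕ.+-mono-≤ (sum-bound λ i → ℕ.m⊓n≤n ∣ class i w ∣ q) (sum-bound λ j → ℕ.∸-monoˡ-≤ 1 (noEdge j)) ⟩
    p * q + m * (p ∸ 1)          ≡⟨ trans (ℕ.+-comm (p * q) (m * (p ∸ 1))) (cong (_+ p * q) (ℕ.*-comm m (p ∸ 1))) ⟩
    (p ∸ 1) * m + p * q          ∎

  full⇒edge : ∀ w j → hits w j ≡ p → MonochromaticEdge B q t c p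
  full⇒edge w j full = record
    { sets          = λ i → proj₁ (hit i)
    ; admissible    = λ i → proj₁ (proj₂ (proj₂ (hit i)))
    ; disjoint      = λ {i} {j} i≢j x∈i x∈j → class-disjoint w i≢j (proj₁ (proj₂ (hit i)) x∈i) (proj₁ (proj₂ (hit j)) x∈j)
    ; colour        = toℕ j
    ; monochromatic = λ i → proj₂ (proj₂ (proj₂ (hit i)))
    }
    where
    hit : ∀ i → Hit (toℕ j) (class i w)
    hit i = does-true (hit? (toℕ j) (class i w)) (#≡n⇒true (types w (2 + toℕ j)) full i)

  long-chain⇒edge : (p ∸ 1) * m + p * q < n → ∀ w → size w ≡ n → Alternating sign w → MonochromaticEdge B q t c p
  long-chain⇒edge bound w size≡n alt with Fin.any? (λ j → hits w j ℕ.≟ p)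
  ... | yes (j , full) = full⇒edge w j full
  ... | no none = contradiction (ℕ.≤-trans (ℕ.≤-reflexive (sym size≡n)) (ℕ.≤-trans (size≤Φ alt noEdge) (Φ≤ w noEdge))) (ℕ.<⇒≱ bound)
    where
    noEdge : NoEdge w
    noEdge j = ℕ.≤∧≢⇒< (#≤n _) λ full → none (j , full)

kneser-prime : ∀ {p} → Prime p → Kneser p
kneser-prime {p} p-prime {suc n} m q t B c t≤q ∣B∣≤ bound c<m =
  let w , size≡ , alternating = tucker n sign sign-equivariant in long-chain⇒edge bound w size≡ alternating
  where
  1<p : 1 < p
  1<p = ℕ.nonTrivial⇒n>1 p {{prime⇒nonTrivial p-prime}}
  open PrimeCase p-prime {{prime⇒nonZero p-prime}} 1<p m q t B c t≤q ∣B∣≤ c<m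
  open ZpTucker p {{prime⇒nonZero p-prime}} 1<p using (tucker)

-- Multiplicativity in the number of sets

∩-small⇒admissible : ∀ {n q t} {B F : Subset n} → t ≤ q → ∣ F ∣ ≡ suc q → ∣ F ∩ B ∣ ≤ q ∸ t → Admissible B q t F
∩-small⇒admissible {q = q} {t} {B} {F} t≤q F≡ F∩B≤ = F≡ , ℕ.+-cancelˡ-≤ (q ∸ t) (suc t) ∣ F ─ B ∣ (begin
  q ∸ t + suc t             ≡⟨ trans (ℕ.+-suc (q ∸ t) t) (cong suc (ℕ.m∸n+n≡m t≤q)) ⟩
  suc q                     ≡⟨ trans (sym F≡) (sym (∣∩∣+∣─∣ F B)) ⟩
  ∣ F ∩ B ∣ + ∣ F ─ B ∣     ≤⟨ ℕ.+-monoˡ-≤ ∣ F ─ B ∣ F∩B≤ ⟩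
  q ∸ t + ∣ F ─ B ∣         ∎)

admissible⇒∩-small : ∀ {n q t} {B F : Subset n} → Admissible B q t F → ∣ F ∩ B ∣ ≤ q ∸ t
admissible⇒∩-small {q = q} {t} {B} {F} (F≡ , t<F─B) = ℕ.m+n≤o⇒m≤o∸n ∣ F ∩ B ∣ (ℕ.≤-pred (begin
  suc (∣ F ∩ B ∣ + t)     ≡⟨ sym (ℕ.+-suc ∣ F ∩ B ∣ t) ⟩
  ∣ F ∩ B ∣ + suc t       ≤⟨ ℕ.+-monoʳ-≤ ∣ F ∩ B ∣ t<F─B ⟩
  ∣ F ∩ B ∣ + ∣ F ─ B ∣   ≡⟨ trans (∣∩∣+∣─∣ F B) F≡ ⟩
  suc q                   ∎))

-- As ∣ B ∣ ≤ q - t, every set of size q + 1 is admissible.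
kneser-1 : Kneser 1
kneser-1 {n} m q t B c t≤q ∣B∣≤ q<n _
  with interpolate {A = ⊥ {n}} {⊤} (suc q) Subset.⊆⊤ (subst (_≤ suc q) (sym (Subset.∣⊥∣≡0 n)) z≤n)
         (subst (suc q ≤_) (sym (Subset.∣⊤∣≡n n)) (subst (_< n) (ℕ.*-identityˡ q) q<n))
... | F , _ , _ , F≡ = record
  { sets          = λ _ → F
  ; admissible    = λ _ → ∩-small⇒admissible {B = B} {F} t≤q F≡
      (ℕ.≤-trans (Subset.∣p∩q∣≤∣q∣ F B) (subst (∣ B ∣ ≤_) (ℕ.*-identityˡ (q ∸ t)) ∣B∣≤))
  ; disjoint      = λ { {zero} {zero} i≢j → contradiction refl i≢j }
  ; colour        = c F
  ; monochromatic = λ _ → refl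
  }

-- Transports subsets along the increasing bijection from a ground set of size ∣ N ∣ onto N, so that
-- `Kneser` can be applied inside N.
expand : ∀ {n} (N : Subset n) → Subset ∣ N ∣ → Subset n
expand []            []      = []
expand (outside ∷ N) A       = outside ∷ expand N A
expand (inside ∷ N)  (a ∷ A) = a ∷ expand N A

restrict : ∀ {n} (N : Subset n) → Subset n → Subset ∣ N ∣
restrict []            []      = []
restrict (outside ∷ N) (b ∷ B) = restrict N B
restrict (inside ∷ N)  (b ∷ B) = b ∷ restrict N B

∣expand∣ : ∀ {n} (N : Subset n) A → ∣ expand N A ∣ ≡ ∣ A ∣
∣expand∣ []            []            = refl
∣expand∣ (outside ∷ N) A             = ∣expand∣ N A
∣expand∣ (inside ∷ N)  (inside ∷ A)  = cong suc (∣expand∣ N A)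
∣expand∣ (inside ∷ N)  (outside ∷ A) = ∣expand∣ N A

∣expand─∣ : ∀ {n} (N B : Subset n) A → ∣ expand N A ─ B ∣ ≡ ∣ A ─ restrict N B ∣
∣expand─∣ []            []            []            = refl
∣expand─∣ (outside ∷ N) (inside ∷ B)  A             = ∣expand─∣ N B A
∣expand─∣ (outside ∷ N) (outside ∷ B) A             = ∣expand─∣ N B A
∣expand─∣ (inside ∷ N)  (inside ∷ B)  (a ∷ A)       = ∣expand─∣ N B A
∣expand─∣ (inside ∷ N)  (outside ∷ B) (inside ∷ A)  = cong suc (∣expand─∣ N B A)
∣expand─∣ (inside ∷ N)  (outside ∷ B) (outside ∷ A) = ∣expand─∣ N B A

∣restrict∣ : ∀ {n} (N B : Subset n) → ∣ restrict N B ∣ ≡ ∣ N ∩ B ∣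
∣restrict∣ []            []            = refl
∣restrict∣ (outside ∷ N) (b ∷ B)       = ∣restrict∣ N B
∣restrict∣ (inside ∷ N)  (inside ∷ B)  = cong suc (∣restrict∣ N B)
∣restrict∣ (inside ∷ N)  (outside ∷ B) = ∣restrict∣ N B

expand⊆ : ∀ {n} (N : Subset n) A → expand N A ⊆ N
expand⊆ (outside ∷ N) A            (there x∈) = there (expand⊆ N A x∈)
expand⊆ (inside ∷ N)  (inside ∷ A) here       = here
expand⊆ (inside ∷ N)  (a ∷ A)      (there x∈) = there (expand⊆ N A x∈)

expand-disjoint : ∀ {n} (N : Subset n) A C → (∀ {x} → x ∈ A → x ∉ C) → ∀ {x} → x ∈ expand N A → x ∉ expand N C
expand-disjoint (outside ∷ N) A            C            disj (there x∈) (there x∈′) = expand-disjoint N A C disj x∈ x∈′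
expand-disjoint (inside ∷ N)  (inside ∷ A) (inside ∷ C) disj here       here        = disj here here
expand-disjoint (inside ∷ N)  (_ ∷ A)      (_ ∷ C)      disj (there x∈) (there x∈′) = expand-disjoint N A C (λ y∈ y∈′ → disj (there y∈) (there y∈′)) x∈ x∈′

expand-admissible : ∀ {n q t} (B N : Subset n) {A} → Admissible (restrict N B) q t A → Admissible B q t (expand N A)
expand-admissible {t = t} B N {A} (A≡ , t<) = trans (∣expand∣ N A) A≡ , subst (t <_) (sym (∣expand─∣ N B A)) t<

EdgeInside : ∀ {n} (B : Subset n) (q t : ℕ) (c : Subset n → ℕ) (r : ℕ) → Subset n → Set
EdgeInside B q t c r N = MonochromaticEdge (restrict N B) q t (c ∘ expand N) r

module _ {n r₁ r₂ q t q₁ t₁ : ℕ} {B : Subset n} {c c₁ : Subset n → ℕ} (outer : MonochromaticEdge B q₁ t₁ c₁ r₂) where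

  private module outer = MonochromaticEdge outer

  nest : (∀ i → Σ (EdgeInside B q t c r₁ (outer.sets i)) λ e → MonochromaticEdge.colour e ≡ c₁ (outer.sets i)) →
         MonochromaticEdge B q t c (r₁ * r₂)
  nest inside-outer = record
    { sets          = sets ∘ split
    ; admissible    = admissible ∘ split
    ; disjoint      = λ {i} {j} i≢j → disjoint (split i) (split j) (i≢j ∘ split-injective i j)
    ; colour        = outer.colour
    ; monochromatic = monochromatic ∘ split
    }
    where
    module inner i₂ = MonochromaticEdge (proj₁ (inside-outer i₂))

    split : Fin (r₁ * r₂) → Fin r₁ × Fin r₂
    split = remQuot {r₁} r₂

    split-injective : ∀ i j → split i ≡ split j → i ≡ j
    split-injective i j eq = trans (sym (Fin.combine-remQuot {r₁} r₂ i))
      (trans (cong (uncurry Fin.combine) eq) (Fin.combine-remQuot {r₁} r₂ j))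

    sets : Fin r₁ × Fin r₂ → Subset n
    sets (i₁ , i₂) = expand (outer.sets i₂) (inner.sets i₂ i₁)

    admissible : ∀ i → Admissible B q t (sets i)
    admissible (i₁ , i₂) = expand-admissible B (outer.sets i₂) (inner.admissible i₂ i₁)

    monochromatic : ∀ i → c (sets i) ≡ outer.colour
    monochromatic (i₁ , i₂) = trans (inner.monochromatic i₂ i₁) (trans (proj₂ (inside-outer i₂)) (outer.monochromatic i₂))

    disjoint : ∀ i j → i ≢ j → ∀ {x} → x ∈ sets i → x ∉ sets j
    disjoint (i₁ , i₂) (j₁ , j₂) i≢j x∈ x∈′ with i₂ Fin.≟ j₂
    ... | no i₂≢j₂ = outer.disjoint i₂≢j₂ (expand⊆ (outer.sets i₂) (inner.sets i₂ i₁) x∈) (expand⊆ (outer.sets j₂) (inner.sets j₂ j₁) x∈′)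
    ... | yes refl = expand-disjoint (outer.sets i₂) (inner.sets i₂ i₁) (inner.sets i₂ j₁)
                       (inner.disjoint i₂ (λ { refl → i≢j refl })) x∈ x∈′

-- A set of size q₁ + 1 that is large outside B contains a monochromatic edge of r₁ sets; colouring it by the
-- colour of that edge makes an edge of r₂ such sets into an edge of r₁ r₂ sets.
kneser-* : ∀ {r₁ r₂} .{{_ : NonZero r₁}} .{{_ : NonZero r₂}} → Kneser r₁ → Kneser r₂ → Kneser (r₁ * r₂)
kneser-* {suc r₁} {suc r₂} K₁ K₂ {n} m q t B c t≤q ∣B∣≤ bound c<m =
  nest outerEdge λ i → proj₂ (choose (MonochromaticEdge.sets outerEdge i)) (MonochromaticEdge.admissible outerEdge i)
  where
  -- In this scope `r₁` is the first factor minus 1. The value of `q₁` is the largest ground set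
  -- size excluded by the bound in `K₁`, so q₁ + 1 elements just suffice; `t₁` is chosen to make q₁
  -- - t₁ the bound on B inside such a set.
  q₁ = r₁ * m + suc r₁ * q
  t₁ = r₁ * m + suc r₁ * t

  q₁∸t₁ : q₁ ∸ t₁ ≡ suc r₁ * (q ∸ t)
  q₁∸t₁ = trans (ℕ.[m+n]∸[m+o]≡n∸o (r₁ * m) (suc r₁ * q) (suc r₁ * t)) (sym (ℕ.*-distribˡ-∸ (suc r₁) q t))

  Inside : Subset n → Set
  Inside = EdgeInside B q t c (suc r₁)

  edgeInside : ∀ N → Admissible B q₁ t₁ N → Inside N
  edgeInside N adm@(N≡ , _) = K₁ m q t (restrict N B) (c ∘ expand N) t≤q
    (begin
      ∣ restrict N B ∣    ≡⟨ ∣restrict∣ N B ⟩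
      ∣ N ∩ B ∣           ≤⟨ admissible⇒∩-small {B = B} {N} adm ⟩
      q₁ ∸ t₁             ≡⟨ q₁∸t₁ ⟩
      suc r₁ * (q ∸ t)    ∎)
    (ℕ.≤-reflexive (sym N≡))
    (λ A A-adm → c<m (expand N A) (expand-admissible B N A-adm))

  -- The colour stands outside the implication to give a total colouring, with value 0 on
  -- inadmissible sets.
  choose : ∀ N → ∃ λ col → Admissible B q₁ t₁ N → Σ (Inside N) λ e → MonochromaticEdge.colour e ≡ col
  choose N with admissible? B q₁ t₁ N
  ... | yes adm = MonochromaticEdge.colour (edgeInside N adm) , λ _ → edgeInside N adm , refl
  ... | no ¬adm = 0 , λ adm → contradiction adm ¬adm

  colour<m : ∀ {N} (e : Inside N) → MonochromaticEdge.colour e < m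
  colour<m {N} e = subst (_< m) (monochromatic zero) (c<m (expand N (sets zero)) (expand-admissible B N (admissible zero)))
    where open MonochromaticEdge e

  size-identity : ∀ r₁ r₂ m q → r₂ * m + suc r₂ * (r₁ * m + suc r₁ * q) ≡ (r₂ + r₁ * suc r₂) * m + suc r₁ * suc r₂ * q
  size-identity = ℕSolver.solve-∀

  ∣B∣≤′ : ∣ B ∣ ≤ suc r₂ * (q₁ ∸ t₁)
  ∣B∣≤′ = begin
    ∣ B ∣                           ≤⟨ ∣B∣≤ ⟩
    suc r₁ * suc r₂ * (q ∸ t)       ≡⟨ cong (_* (q ∸ t)) (ℕ.*-comm (suc r₁) (suc r₂)) ⟩
    suc r₂ * suc r₁ * (q ∸ t)       ≡⟨ ℕ.*-assoc (suc r₂) (suc r₁) (q ∸ t) ⟩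
    suc r₂ * (suc r₁ * (q ∸ t))     ≡⟨ cong (suc r₂ *_) (sym q₁∸t₁) ⟩
    suc r₂ * (q₁ ∸ t₁)              ∎

  bound′ : r₂ * m + suc r₂ * q₁ < n
  bound′ = subst (_< n) (sym (size-identity r₁ r₂ m q)) bound

  outerEdge : MonochromaticEdge B q₁ t₁ (proj₁ ∘ choose) (suc r₂)
  outerEdge = K₂ m q₁ t₁ B (proj₁ ∘ choose) (ℕ.+-monoʳ-≤ (r₁ * m) (ℕ.*-monoʳ-≤ (suc r₁) t≤q)) ∣B∣≤′ bound′
    (λ N adm → let e , eq = proj₂ (choose N) adm in subst (_< m) eq (colour<m e))

kneser-product : ∀ {ps} → All Prime ps → Kneser (product ps)
kneser-product []                           = kneser-1
kneser-product {p ∷ ps} (p-prime ∷ ps-prime) =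
  kneser-* {p} {product ps} {{prime⇒nonZero p-prime}} {{productOfPrimes≢0 ps-prime}} (kneser-prime p-prime) (kneser-product ps-prime)

kneser : ∀ r .{{_ : NonZero r}} → Kneser r
kneser r = subst Kneser (sym isFactorisation) (kneser-product factorsPrime)
  where open PrimeFactorisation (factorise r)

-- From disjoint sets to edges of the Kneser hypergraph

size-bounded-below : ∀ {n} k (A : Subset n) → (∀ {x} → x ∈ A → k ≤ toℕ x) → ∣ A ∣ ≤ n ∸ k
size-bounded-below zero    A             _  = Subset.∣p∣≤n A
size-bounded-below (suc k) []            _  = z≤n
size-bounded-below (suc k) (inside ∷ A)  k≤ with () ← k≤ here
size-bounded-below (suc k) (outside ∷ A) k≤ = size-bounded-below k A (ℕ.≤-pred ∘ k≤ ∘ there)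

∈-lastSet⁻ : ∀ n a {x} → x ∈ lastSet n a → n ∸ a ≤ toℕ x
∈-lastSet⁻ n a {x} x∈ with n ∸ a ℕ.≤? toℕ x | trans (sym (lookup∘tabulate _ x)) ([]=⇒lookup x∈)
... | yes n∸a≤x | _  = n∸a≤x
... | no _      | ()

∣lastSet∣≤ : ∀ n a → a < n → ∣ lastSet n a ∣ ≤ a
∣lastSet∣≤ n a a<n = ℕ.≤-trans (size-bounded-below (n ∸ a) (lastSet n a) (∈-lastSet⁻ n a)) (ℕ.≤-reflexive (ℕ.m∸[m∸n]≡n (ℕ.<⇒≤ a<n)))

-- Any E with F ─ E inside B must contain F ─ B.
large-difference : ∀ {n s} (F B : Subset n) → s < ∣ F ─ B ∣ → ¬ (F ⊆[ s ] B)
large-difference F B s< (E , ∣E∣≤s , F─E⊆B) = ℕ.<⇒≱ s< (ℕ.≤-trans (Subset.p⊆q⇒∣p∣≤∣q∣ F─B⊆E) ∣E∣≤s)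
  where
  F─B⊆E : F ─ B ⊆ E
  F─B⊆E {x} x∈ with x Subset.∈? E
  ... | yes x∈E = x∈E
  ... | no x∉E = contradiction (F─E⊆B (Subset.x∈p∧x∉q⇒x∈p─q (Subset.p─q⊆p F B x∈) x∉E)) (─⇒∉ F B x∈)

∣∪∣≤ : ∀ {n} (A C : Subset n) → ∣ A ∪ C ∣ ≤ ∣ A ∣ + ∣ C ∣
∣∪∣≤ []            []            = z≤n
∣∪∣≤ (inside ∷ A)  (c ∷ C)       = s≤s (ℕ.≤-trans (∣∪∣≤ A C) (ℕ.+-monoʳ-≤ ∣ A ∣ (Subset.∣p∣≤∣x∷p∣ c C)))
∣∪∣≤ (outside ∷ A) (outside ∷ C) = ∣∪∣≤ A C
∣∪∣≤ (outside ∷ A) (inside ∷ C)  = ℕ.≤-trans (s≤s (∣∪∣≤ A C)) (ℕ.≤-reflexive (sym (ℕ.+-suc ∣ A ∣ ∣ C ∣)))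

-- A common element cannot lie in both A₁ and A₂, so it was added to at least one of them.
∣∩∣≤-enlarged : ∀ {n} {A₁ A₂ F₁ F₂ : Subset n} → (∀ {x} → x ∈ A₁ → x ∉ A₂) → ∣ F₁ ∩ F₂ ∣ ≤ ∣ F₁ ─ A₁ ∣ + ∣ F₂ ─ A₂ ∣
∣∩∣≤-enlarged {A₁ = A₁} {A₂} {F₁} {F₂} disj = ℕ.≤-trans (Subset.p⊆q⇒∣p∣≤∣q∣ cover) (∣∪∣≤ (F₁ ─ A₁) (F₂ ─ A₂))
  where
  cover : F₁ ∩ F₂ ⊆ (F₁ ─ A₁) ∪ (F₂ ─ A₂)
  cover {x} x∈ with Subset.x∈p∩q⁻ F₁ F₂ x∈ | x Subset.∈? A₁
  ... | x∈F₁ , _ | no x∉A₁  = Subset.x∈p∪q⁺ (inj₁ (Subset.x∈p∧x∉q⇒x∈p─q x∈F₁ x∉A₁))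
  ... | _ , x∈F₂ | yes x∈A₁ = Subset.x∈p∪q⁺ (inj₂ (Subset.x∈p∧x∉q⇒x∈p─q x∈F₂ (disj x∈A₁)))

∣─∣-⊆ : ∀ {n} {A F : Subset n} → A ⊆ F → ∣ A ∣ + ∣ F ─ A ∣ ≤ ∣ F ∣
∣─∣-⊆ {A = A} {F} A⊆F = ℕ.≤-trans
  (ℕ.+-monoˡ-≤ ∣ F ─ A ∣ (Subset.p⊆q⇒∣p∣≤∣q∣ λ x∈A → Subset.x∈p∩q⁺ (A⊆F x∈A , x∈A)))
  (ℕ.≤-reflexive (∣∩∣+∣─∣ F A))

-- At most q - t elements of A lie in B, which leaves room for u + t + 1 elements outside B.
enlarge-bound : ∀ {n q t u} {A B : Subset n} → t ≤ q → Admissible B q t A → ∣ A ∩ B ∣ + suc (u + t) ≤ suc q + u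
enlarge-bound {q = q} {t} {u} {A} {B} t≤q adm = begin
  ∣ A ∩ B ∣ + suc (u + t)   ≤⟨ ℕ.+-monoˡ-≤ (suc (u + t)) (admissible⇒∩-small {B = B} {A} adm) ⟩
  q ∸ t + suc (u + t)       ≡⟨ rearrange (q ∸ t) u t ⟩
  suc (q ∸ t + t + u)       ≡⟨ cong (λ x → suc (x + u)) (ℕ.m∸n+n≡m t≤q) ⟩
  suc q + u                 ∎
  where
  rearrange : ∀ x u t → x + suc (u + t) ≡ suc (x + t + u)
  rearrange = ℕSolver.solve-∀

-- The part of A outside B is first enlarged to a set C outside B with at least u + t + 1 elements;
-- the maximum covers the case that A has enough already. Together with A ∩ B it still fits into the
-- prescribed size, and the rest is filled up arbitrarily.
enlarge : ∀ {n} {q t u} {A B : Subset n} → suc q + u ≤ n → u + t + ∣ B ∣ < n → t ≤ q → Admissible B q t A →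
          ∃ λ F → A ⊆ F × ∣ F ∣ ≡ suc q + u × u + t < ∣ F ─ B ∣
enlarge {n} {q} {t} {u} {A} {B} k≤n B-small t≤q A-adm@(A≡ , _)
  with interpolate {A = A ─ B} {⊤ ─ B} (∣ A ─ B ∣ ⊔ suc (u + t)) (─-monoˡ {A = A} B Subset.⊆⊤) (ℕ.m≤m⊔n ∣ A ─ B ∣ (suc (u + t)))
         (ℕ.⊔-lub (∣─∣-mono {A = A} B Subset.⊆⊤) (ℕ.+-cancelˡ-≤ ∣ B ∣ _ _ (begin
           ∣ B ∣ + suc (u + t)          ≡⟨ trans (ℕ.+-suc ∣ B ∣ (u + t)) (cong suc (ℕ.+-comm ∣ B ∣ (u + t))) ⟩
           suc (u + t + ∣ B ∣)          ≤⟨ B-small ⟩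
           n                            ≡⟨ trans (sym (Subset.∣⊤∣≡n n)) (sym (∣∩∣+∣─∣ ⊤ B)) ⟩
           ∣ ⊤ ∩ B ∣ + ∣ ⊤ ─ B ∣        ≤⟨ ℕ.+-monoˡ-≤ ∣ ⊤ ─ B ∣ (Subset.∣p∩q∣≤∣q∣ ⊤ B) ⟩
           ∣ B ∣ + ∣ ⊤ ─ B ∣            ∎)))
... | C , A─B⊆C , C⊆⊤─B , C≡
  with interpolate {A = (A ∩ B) ∪ C} {⊤} (suc q + u) Subset.⊆⊤ (begin
           ∣ (A ∩ B) ∪ C ∣                                              ≤⟨ ∣∪∣≤ (A ∩ B) C ⟩
           ∣ A ∩ B ∣ + ∣ C ∣                                            ≡⟨ cong (∣ A ∩ B ∣ +_) C≡ ⟩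
           ∣ A ∩ B ∣ + (∣ A ─ B ∣ ⊔ suc (u + t))                        ≡⟨ ℕ.+-distribˡ-⊔ ∣ A ∩ B ∣ ∣ A ─ B ∣ (suc (u + t)) ⟩
           (∣ A ∩ B ∣ + ∣ A ─ B ∣) ⊔ (∣ A ∩ B ∣ + suc (u + t))          ≤⟨ ℕ.⊔-lub (ℕ.≤-trans (ℕ.≤-reflexive (trans (∣∩∣+∣─∣ A B) A≡)) (ℕ.m≤m+n (suc q) u)) (enlarge-bound {A = A} {B} t≤q A-adm) ⟩
           suc q + u                                                    ∎)
         (subst (suc q + u ≤_) (sym (Subset.∣⊤∣≡n n)) k≤n)
... | F , U⊆F , _ , F≡ = F , A⊆F , F≡ , (begin
  suc (u + t)  ≤⟨ ℕ.m≤n⊔m ∣ A ─ B ∣ (suc (u + t)) ⟩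
  ∣ A ─ B ∣ ⊔ suc (u + t) ≡⟨ sym C≡ ⟩
  ∣ C ∣        ≤⟨ Subset.p⊆q⇒∣p∣≤∣q∣ (λ x∈C → Subset.x∈p∧x∉q⇒x∈p─q (U⊆F (Subset.x∈p∪q⁺ (inj₂ x∈C))) (─⇒∉ ⊤ B (C⊆⊤─B x∈C))) ⟩
  ∣ F ─ B ∣    ∎)
  where
  A⊆F : A ⊆ F
  A⊆F {x} x∈A with x Subset.∈? B
  ... | yes x∈B = U⊆F (Subset.x∈p∪q⁺ (inj₁ (Subset.x∈p∩q⁺ (x∈A , x∈B))))
  ... | no x∉B  = U⊆F (Subset.x∈p∪q⁺ (inj₂ (A─B⊆C (Subset.x∈p∧x∉q⇒x∈p─q x∈A x∉B))))

-- The parameters stand for u = ⌊ s /2⌋, t = ⌈ s /2⌉ and e = k - s - 1; k and s are written as sums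
-- of them to avoid truncated subtraction.
module _ {n : ℕ} (r u t e a m : ℕ) .{{_ : NonZero r}} (u≤t : u ≤ t) (a<n : a < n) (rk≤n : r * (suc (t + e) + u) ≤ n)
  (a≤ : a ≤ r * e) (c : H n (suc (t + e) + u) a (u + t) → Fin m) (bound : (r ∸ 1) * m + r * (t + e) < n) where

  private
    q = t + e
    k = suc q + u
    B = lastSet n a

    q∸t≡e : q ∸ t ≡ e
    q∸t≡e = ℕ.m+n∸m≡n t e

    k≤n : k ≤ n
    k≤n = ℕ.≤-trans (ℕ.m≤n*m k r) rk≤n

    B-small : u + t + ∣ B ∣ < n
    B-small = begin
      suc (u + t + ∣ B ∣)           ≤⟨ ℕ.+-monoʳ-≤ (suc (u + t)) (ℕ.≤-trans (∣lastSet∣≤ n a a<n) a≤) ⟩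
      suc (u + t) + r * e           ≤⟨ ℕ.+-monoˡ-≤ (r * e) (ℕ.m≤n*m (suc (u + t)) r) ⟩
      r * suc (u + t) + r * e       ≡⟨ rearrange r u t e ⟩
      r * (suc (t + e) + u)         ≤⟨ rk≤n ⟩
      n                             ∎
      where
      rearrange : ∀ r u t e → r * suc (u + t) + r * e ≡ r * (suc (t + e) + u)
      rearrange = ℕSolver.solve-∀

    Enlarged : Subset n → ℕ → Set
    Enlarged A col = Σ (H n k a (u + t)) λ F → A ⊆ proj₁ F × toℕ (c F) ≡ col

    choose : ∀ A → ∃ λ col → Admissible B q t A → Enlarged A col
    choose A with admissible? B q t A
    ... | no ¬adm = 0 , λ adm → contradiction adm ¬adm
    ... | yes adm = let F , A⊆F , F≡ , s< = enlarge k≤n B-small (ℕ.m≤m+n t e) adm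
                        F′ = F , F≡ , large-difference F B s<
                    in toℕ (c F′) , λ _ → F′ , (λ {x} → A⊆F {x}) , refl

    edge : MonochromaticEdge B q t (proj₁ ∘ choose) r
    edge = kneser r m q t B (proj₁ ∘ choose) (ℕ.m≤m+n t e)
      (ℕ.≤-trans (∣lastSet∣≤ n a a<n) (subst (λ x → a ≤ r * x) (sym q∸t≡e) a≤)) bound
      (λ A adm → let F , _ , eq = proj₂ (choose A) adm in subst (_< m) eq (Fin.toℕ<n (c F)))

    open MonochromaticEdge edge

    enlarged : ∀ i → Enlarged (sets i) (proj₁ (choose (sets i)))
    enlarged i = proj₂ (choose (sets i)) (admissible i)

    F : Fin r → Subset n
    F i = proj₁ (proj₁ (enlarged i))

    ∣F∣ : ∀ i → ∣ F i ∣ ≡ k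
    ∣F∣ i = proj₁ (proj₂ (proj₁ (enlarged i)))

    ∣F─A∣≤u : ∀ i → ∣ F i ─ sets i ∣ ≤ u
    ∣F─A∣≤u i = ℕ.+-cancelˡ-≤ (suc q) _ _ (begin
      suc q + ∣ F i ─ sets i ∣      ≡⟨ cong (_+ ∣ F i ─ sets i ∣) (sym (proj₁ (admissible i))) ⟩
      ∣ sets i ∣ + ∣ F i ─ sets i ∣ ≤⟨ ∣─∣-⊆ (proj₁ (proj₂ (enlarged i))) ⟩
      ∣ F i ∣                       ≡⟨ ∣F∣ i ⟩
      suc q + u                     ∎)

    -- Each set gains at most u elements, and 2u ≤ u + t.
    sparse : ∀ i j → i ≢ j → ∣ F i ∩ F j ∣ ≤ u + t
    sparse i j i≢j = ℕ.≤-trans (∣∩∣≤-enlarged {A₁ = sets i} {sets j} {F i} {F j} (disjoint i≢j)) (ℕ.+-mono-≤ (∣F─A∣≤u i) (ℕ.≤-trans (∣F─A∣≤u j) u≤t))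

    -- Equal sets with different indices would meet in all k elements, more than the u + t that
    -- `sparse` allows.
    distinct : ∀ {i j} → F i ≡ F j → i ≡ j
    distinct {i} {j} Fi≡Fj with i Fin.≟ j
    ... | yes i≡j = i≡j
    ... | no i≢j = contradiction (begin
      k                 ≡⟨ sym (∣F∣ i) ⟩
      ∣ F i ∣           ≡⟨ cong ∣_∣ (trans (sym (Subset.∩-idem (F i))) (cong (F i ∩_) Fi≡Fj)) ⟩
      ∣ F i ∩ F j ∣     ≤⟨ sparse i j i≢j ⟩
      u + t             ≤⟨ ℕ.+-monoʳ-≤ u (ℕ.m≤m+n t e) ⟩
      u + q             ≡⟨ ℕ.+-comm u q ⟩
      q + u             ∎) (ℕ.<⇒≱ ℕ.≤-refl)

  many-elements⇒¬proper : ¬ ProperColouring n k a (u + t) r m c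
  many-elements⇒¬proper proper = proper
    (record { members = λ i → proj₁ (enlarged i) ; distinct = distinct ; sparse = sparse })
    λ i j → Fin.toℕ-injective (trans (colour≡ i) (sym (colour≡ j)))
    where
    colour≡ : ∀ i → toℕ (c (proj₁ (enlarged i))) ≡ colour
    colour≡ i = trans (proj₂ (proj₂ (enlarged i))) (monochromatic i)

<-⌈/⌉ : ∀ {m} x d → m < ⌈ x /' suc d ⌉ → m * suc d < x
<-⌈/⌉ {m} x d m< = ℕ.+-cancelʳ-≤ d (suc (m * suc d)) x (begin
  suc (m * suc d) + d           ≡⟨ rearrange m d ⟩
  suc m * suc d                 ≤⟨ ℕ.*-monoˡ-≤ (suc d) m< ⟩
  (x + d) / suc d * suc d       ≤⟨ m/n*n≤m (x + d) (suc d) ⟩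
  x + d                         ∎)
  where
  rearrange : ∀ m d → suc (m * suc d) + d ≡ suc m * suc d
  rearrange = ℕSolver.solve-∀

lower-bound : ∀ {n k s a m} d u t e → k ≡ suc (t + e) + u → s ≡ u + t → u ≤ t → a < n → suc (suc d) * k ≤ n →
              a ≤ suc (suc d) * e → (c : H n k a s → Fin m) → ProperColouring n k a s (suc (suc d)) m c →
              ⌈ (n ∸ suc (suc d) * (k ∸ u ∸ 1)) /' suc d ⌉ ≤ m
lower-bound {n} {m = m} d u t e refl refl u≤t a<n rk≤n a≤ c proper = ℕ.≮⇒≥ λ m<χ →
  many-elements⇒¬proper r u t e _ m u≤t a<n rk≤n a≤ c (bound (<-⌈/⌉ (n ∸ r * (suc (t + e) + u ∸ u ∸ 1)) d m<χ)) proper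
  where
  r = suc (suc d)
  bound : m * suc d < n ∸ r * (suc (t + e) + u ∸ u ∸ 1) → suc d * m + r * (t + e) < n
  bound m< = begin
    suc (suc d * m + r * (t + e))   ≡⟨ cong (λ x → suc (x + r * (t + e))) (ℕ.*-comm (suc d) m) ⟩
    suc (m * suc d) + r * (t + e)   ≤⟨ ℕ.m≤o∸n⇒m+n≤o (suc (m * suc d)) rq≤n (subst (λ q → m * suc d < n ∸ r * (q ∸ 1)) (ℕ.m+n∸n≡m (suc (t + e)) u) m<) ⟩
    n                               ∎
    where
    -- Guarantees that the subtraction from n is not truncated.
    rq≤n : r * (t + e) ≤ n
    rq≤n = ℕ.≤-trans (ℕ.*-monoʳ-≤ r (ℕ.≤-trans (ℕ.n≤1+n (t + e)) (ℕ.m≤m+n (suc (t + e)) u))) rk≤n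

theorem7 : (n k r s a : ℕ) → 2 ≤ k → 2 ≤ r → a < n → r * k ≤ n → s < k →
    a ≤ r * (k ∸ s ∸ 1) →
    χ≥ n k a s r ⌈ (n ∸ r * (k ∸ ⌊ s /2⌋ ∸ 1)) /' (r ∸ 1) ⌉
theorem7 n k (suc (suc d)) s a _ (s≤s (s≤s _)) a<n rk≤n s<k a≤ m c proper =
  lower-bound d ⌊ s /2⌋ ⌈ s /2⌉ (k ∸ s ∸ 1) k≡ (sym halves) (ℕ.⌊n/2⌋≤⌈n/2⌉ s) a<n rk≤n a≤ c proper
  where
  halves : ⌊ s /2⌋ + ⌈ s /2⌉ ≡ s
  halves = ℕ.⌊n/2⌋+⌈n/2⌉≡n s
  rearrange : ∀ u t e → suc (u + t) + e ≡ suc (t + e) + u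
  rearrange = ℕSolver.solve-∀
  k≡ : k ≡ suc (⌈ s /2⌉ + (k ∸ s ∸ 1)) + ⌊ s /2⌋
  k≡ = begin-equality
    k                                              ≡⟨ sym (ℕ.m+[n∸m]≡n s<k) ⟩
    suc s + (k ∸ suc s)                            ≡⟨ cong (suc s +_) (trans (cong (k ∸_) (ℕ.+-comm 1 s)) (sym (ℕ.∸-+-assoc k s 1))) ⟩
    suc s + (k ∸ s ∸ 1)                            ≡⟨ cong (λ x → suc x + (k ∸ s ∸ 1)) (sym halves) ⟩
    suc (⌊ s /2⌋ + ⌈ s /2⌉) + (k ∸ s ∸ 1)          ≡⟨ rearrange ⌊ s /2⌋ ⌈ s /2⌉ (k ∸ s ∸ 1) ⟩
    suc (⌈ s /2⌉ + (k ∸ s ∸ 1)) + ⌊ s /2⌋          ∎
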